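{- Let $T$ be a tree. Then $\mathrm{pthin}(T)=2$ if and only if $T$ has at least one vertex of degree at least $3$ and $T$ contains no induced subgraph isomorphic to any tree in the families $T_0$, $T_1$, $T_2^{i,j,k}$ ($i,j,k\ge 2$), $T_3^{i,j}$ ($i,j\ge 2$), $T_4^{i}$ ($i\ge 2$), $T_5^{i,j}$ ($i,j\ge 1$) defined in the context.
   Context: For a graph $G=(V,E)$, a linear ordering $<$ of $V$ and a partition of $V$ into classes are called strongly consistent if for every triple $r<s<t$ of vertices with $rt\in E$: if $r$ and $s$ belong to the same class then $st\in E$, and if $s$ and $t$ belong to the same class then $rs\in E$. The proper thinness $\mathrm{pthin}(G)$ is the minimum $k$ such that some ordering of $V$ and some partition of $V$ into $k$ classes are strongly consistent. Say that a vertex $x$ "carries $m$ pendant leaves" if $m$ new vertices of degree $1$ are attached to $x$. The trees are (each consisting exactly of the listed vertices and edges): $T_0$: a vertex $c$ with five neighbors $a_1,\dots,a_5$, each $a_\ell$ carrying one pendant leaf (the subdivided star $K_{1,5}$, 11 vertices). $T_1$: a vertex $c$ with three neighbors $x,y,z$, each carrying three pendant leaves (13 vertices). $T_2^{i,j,k}$: a vertex $c$ and three paths from $c$ of lengths $i,j,k\ge 2$, pairwise sharing only $c$, ending at $x,y,z$ respectively; each of $x,y,z$ carries two pendant leaves. $T_3^{i,j}$: a vertex $c$ adjacent to a vertex $u$ carrying three pendant leaves, plus two paths from $c$ of lengths $i,j\ge 2$, sharing only $c$ (and disjoint from $u$), ending at $x,y$; each of $x,y$ carries two pendant leaves. $T_4^{i}$: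 a vertex $c$ adjacent to two vertices $u,u'$ each carrying three pendant leaves, plus a path from $c$ of length $i\ge2$ (disjoint from $u,u'$) ending at $x$, which carries two pendant leaves. $T_5^{i,j}$: a vertex $c$ adjacent to a leaf $\ell$ and to a vertex $w$ carrying two pendant leaves, plus two paths from $c$ of lengths $i,j\ge 1$, sharing only $c$ (and disjoint from $\ell,w$), ending at $x,y$; each of $x,y$ carries two pendant leaves. -}

module Defs where

open import Data.Empty using (⊥)
open import Data.Fin using (Fin; zero; suc; inject₁; fromℕ)
open import Data.Fin.Subset using (Subset; _∈_)
open import Data.List using (length; filter; allFin)
open import Data.Nat using (ℕ; zero; suc; _+_; _≤_; pred)
open import Data.Product using (Σ; ∃; _×_; _,_; proj₁)
open import Data.Sum using (_⊎_; inj₁; inj₂)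
open import Data.Sum.Properties using (≡-dec)
open import Data.Unit using (⊤; tt)
import Data.Unit.Properties as ⊤ₚ
open import Function.Bundles using (_⇔_; _↔_; Inverse)
open import Function.Definitions using (Injective; Surjective)
open import Level using (0ℓ)
open import Relation.Binary using (Rel; Symmetric; Decidable; DecidableEquality; IsStrictTotalOrder)
open import Relation.Binary.Construct.Closure.ReflexiveTransitive using (Star)
open import Relation.Binary.PropositionalEquality using (_≡_; refl)
open import Relation.Nullary using (¬_; no)
open import Relation.Nullary.Decidable using (_×-dec_)

record Graph (V : Set) : Set₁ where
  infix 4 _~_ _~?_
  field
    _~_    : Rel V 0ℓ
    _~?_   : Decidable _~_
    sym    : Symmetric _~_
    irrefl : ∀ {v} → ¬ (v ~ v)

degree : ∀ {n} → Graph (Fin n) → Fin n → ℕ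
degree {n} G v = length (filter (v ~?_) (allFin n))
  where open Graph G

-- A cycle on the k + 3 distinct vertices vertex zero, vertex (suc zero), ….
record Cycle {V : Set} (G : Graph V) : Set where
  open Graph G
  field
    k         : ℕ
    vertex    : Fin (3 + k) → V
    injective : Injective _≡_ _≡_ vertex
    step      : (i : Fin (2 + k)) → vertex (inject₁ i) ~ vertex (suc i)
    close     : vertex (fromℕ (2 + k)) ~ vertex zero

record IsTree {V : Set} (G : Graph V) : Set where
  open Graph G
  field
    nonempty  : V
    connected : ∀ u v → Star _~_ u v
    acyclic   : ¬ Cycle G

record _≅_ {V W : Set} (G : Graph V) (H : Graph W) : Set where
  private
    module G = Graph G
    module H = Graph H
  field
    bijection : V ↔ W
  open Inverse bijection using (to)
  field
    edges : ∀ u v → (u G.~ v) ⇔ (to u H.~ to v)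

induced : ∀ {n} → Graph (Fin n) → (S : Subset n) → Graph (∃ (_∈ S))
induced G S = record
  { _~_    = λ u v → proj₁ u ~ proj₁ v
  ; _~?_   = λ u v → proj₁ u ~? proj₁ v
  ; sym    = sym
  ; irrefl = irrefl
  }
  where open Graph G

ContainsInduced : ∀ {n} {W : Set} → Graph (Fin n) → Graph W → Set
ContainsInduced G H = ∃ λ S → H ≅ induced G S

StronglyConsistent : {V C : Set} → Graph V → Rel V 0ℓ → (V → C) → Set
StronglyConsistent G _<_ class =
  ∀ {r s t} → r < s → s < t → r ~ t →
    (class r ≡ class s → s ~ t) × (class s ≡ class t → r ~ s)
  where open Graph G

-- The class map is onto because the classes of a partition are nonempty.
ProperlyThin : {V : Set} → Graph V → ℕ → Set₁
ProperlyThin {V} G k =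
  Σ (Rel V 0ℓ) λ _<_ → Σ (V → Fin k) λ class →
    IsStrictTotalOrder _≡_ _<_ ×
    Surjective _≡_ _≡_ class ×
    StronglyConsistent G _<_ class

HasProperThinness : {V : Set} → Graph V → ℕ → Set₁
HasProperThinness G k = ProperlyThin G k × (∀ j → ProperlyThin G j → k ≤ j)

-- t ◂ s is the disjoint union of the rooted trees t and
-- s with an edge joining their roots, rooted at the root of t.

infixl 5 _◂_

data RootedTree : Set where
  •   : RootedTree
  _◂_ : RootedTree → RootedTree → RootedTree

Vertex : RootedTree → Set
Vertex •       = ⊤
Vertex (t ◂ s) = Vertex t ⊎ Vertex s

root : ∀ t → Vertex t
root •       = tt
root (t ◂ s) = inj₁ (root t)

_≟ᵛ_ : ∀ {t} → DecidableEquality (Vertex t)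
_≟ᵛ_ {•}     = ⊤ₚ._≟_
_≟ᵛ_ {t ◂ s} = ≡-dec (_≟ᵛ_ {t}) (_≟ᵛ_ {s})

Edge : ∀ t → Rel (Vertex t) 0ℓ
Edge •       _        _        = ⊥
Edge (t ◂ s) (inj₁ u) (inj₁ v) = Edge t u v
Edge (t ◂ s) (inj₁ u) (inj₂ v) = u ≡ root t × v ≡ root s
Edge (t ◂ s) (inj₂ u) (inj₁ v) = u ≡ root s × v ≡ root t
Edge (t ◂ s) (inj₂ u) (inj₂ v) = Edge s u v

edge? : ∀ t → Decidable (Edge t)
edge? •       _        _        = no λ ()
edge? (t ◂ s) (inj₁ u) (inj₁ v) = edge? t u v
edge? (t ◂ s) (inj₁ u) (inj₂ v) = (_≟ᵛ_ {t} u (root t)) ×-dec (_≟ᵛ_ {s} v (root s))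
edge? (t ◂ s) (inj₂ u) (inj₁ v) = (_≟ᵛ_ {s} u (root s)) ×-dec (_≟ᵛ_ {t} v (root t))
edge? (t ◂ s) (inj₂ u) (inj₂ v) = edge? s u v

edge-sym : ∀ t → Symmetric (Edge t)
edge-sym (t ◂ s) {inj₁ u} {inj₁ v} e       = edge-sym t e
edge-sym (t ◂ s) {inj₁ u} {inj₂ v} (p , q) = q , p
edge-sym (t ◂ s) {inj₂ u} {inj₁ v} (p , q) = q , p
edge-sym (t ◂ s) {inj₂ u} {inj₂ v} e       = edge-sym s e

edge-irrefl : ∀ t {v} → ¬ Edge t v v
edge-irrefl (t ◂ s) {inj₁ v} e = edge-irrefl t e
edge-irrefl (t ◂ s) {inj₂ v} e = edge-irrefl s e

graph : ∀ t → Graph (Vertex t)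
graph t = record
  { _~_    = Edge t
  ; _~?_   = edge? t
  ; sym    = edge-sym t
  ; irrefl = edge-irrefl t
  }

-- The root carries m pendant leaves.
star : ℕ → RootedTree
star zero    = •
star (suc m) = star m ◂ •

stem : ℕ → RootedTree → RootedTree
stem zero    s = s
stem (suc m) s = • ◂ stem m s

-- For i ≥ 1: the roots of t and s are joined by a path of length i, that is,
-- through i ∸ 1 new vertices.  Used only with i ≥ 1.
infixl 5 _◂[_]_

_◂[_]_ : RootedTree → ℕ → RootedTree → RootedTree
t ◂[ i ] s = t ◂ stem (pred i) s

-- In each case the root is the vertex c.

T₀ : RootedTree
T₀ = • ◂ star 1 ◂ star 1 ◂ star 1 ◂ star 1 ◂ star 1

T₁ : RootedTree
T₁ = • ◂ star 3 ◂ star 3 ◂ star 3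

T₂ : ℕ → ℕ → ℕ → RootedTree
T₂ i j k = • ◂[ i ] star 2 ◂[ j ] star 2 ◂[ k ] star 2

T₃ : ℕ → ℕ → RootedTree
T₃ i j = • ◂ star 3 ◂[ i ] star 2 ◂[ j ] star 2

T₄ : ℕ → RootedTree
T₄ i = • ◂ star 3 ◂ star 3 ◂[ i ] star 2

T₅ : ℕ → ℕ → RootedTree
T₅ i j = • ◂ • ◂ star 2 ◂[ i ] star 2 ◂[ j ] star 2

data Forbidden : RootedTree → Set where
  t₀ : Forbidden T₀
  t₁ : Forbidden T₁
  t₂ : ∀ {i j k} → 2 ≤ i → 2 ≤ j → 2 ≤ k → Forbidden (T₂ i j k)
  t₃ : ∀ {i j} → 2 ≤ i → 2 ≤ j → Forbidden (T₃ i j)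
  t₄ : ∀ {i} → 2 ≤ i → Forbidden (T₄ i)
  t₅ : ∀ {i j} → 1 ≤ i → 1 ≤ j → Forbidden (T₅ i j)

module Submission where

-- In a strongly consistent order of a tree with two classes, an edge cannot jump over a vertex
-- of degree at least 3 that is adjacent to neither of its ends.  Hence a connected set avoiding u
-- and its neighbours lies on one side of such a vertex u.  In T₁, …, T₅ take the centres of the
-- three stars at the ends of the branches at c: one of them lies between the other two, which are
-- joined by a path that comes close to it only at c, and a local analysis excludes this.  In T₀
-- the vertex c has at most two neighbours in its own class, and of its neighbours in the other
-- class only the first and the last may have further neighbours.
--
-- Conversely, without forbidden subtrees there is a path (the spine) such that off the spine each
-- spine vertex carries either leaves and at most two longer paths, or just one vertex with two
-- paths.  Let the spine be one class and the rest the other.  Following the spine, surround each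
-- spine vertex v by what it carries: (path reversed) v (leaves) (path), respectively
-- (path reversed, vertex) v (path).

open import Data.Empty using (⊥; ⊥-elim)
open import Data.Fin using (Fin; zero; suc; inject₁; fromℕ)
import Data.Fin as Fin
open import Data.Fin.Properties using (injective⇒≤)
open import Data.Fin.Subset using (Subset)
import Data.Fin.Subset as Subset
open import Data.List using (List; []; _∷_; _++_; length; lookup; filter; allFin)
import Data.List as List
open import Data.List.Membership.Propositional using (_∈_)
open import Data.List.Membership.Propositional.Properties using (∈-map⁻; ∈-lookup; ∈-allFin; ∈-filter⁺)
open import Data.List.Relation.Binary.Permutation.Propositional using (_↭_; refl; prep; swap; trans; ↭-refl; ↭-sym)
open import Data.List.Relation.Binary.Permutation.Propositional.Properties using (shift)
open import Data.List.Relation.Binary.Sublist.Heterogeneous using (Sublist; []; _∷_; _∷ʳ_; minimum)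
open import Data.List.Relation.Binary.Sublist.Propositional using (_⊆_)
open import Data.List.Relation.Binary.Sublist.Propositional.Properties using (All-resp-⊆)
open import Data.List.Relation.Unary.All as All using ([]; _∷_; All)
open import Data.List.Relation.Unary.All.Properties using (all-filter)
open import Data.List.Relation.Unary.AllPairs using ([]; _∷_)
open import Data.List.Relation.Unary.Any using (here; there; index)
open import Data.List.Relation.Unary.Any.Properties using (lookup-index)
open import Data.List.Relation.Unary.Unique.Propositional using (Unique)
open import Data.List.Relation.Unary.Unique.Propositional.Properties using (map⁺; ++⁺; Unique[x∷xs]⇒x∉xs; filter⁺; allFin⁺)
open import Data.Nat using (ℕ; zero; suc; _+_; _≤_; z≤n; s≤s)
open import Data.Nat.Properties using (+-suc)
open import Data.Product using (∃; _×_; _,_; proj₁; proj₂; uncurry)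
open import Data.Sum using (_⊎_; inj₁; inj₂; [_,_])
import Data.Sum as Sum
open import Data.Sum.Properties using (inj₁-injective; inj₂-injective)
open import Data.Sum.Relation.Binary.LeftOrder using (_⊎-<_; ₁∼₂; ₁∼₁; ₂∼₂; ⊎-<-transitive; drop-inj₁; drop-inj₂)
open import Data.Unit using (tt)
open import Data.Vec using (tabulate)
open import Data.Vec.Properties using (lookup∘tabulate; []=⇒lookup; lookup⇒[]=)
open import Data.Vec.Properties.WithK using ([]=-irrelevant)
open import Function using (_∘_; id; flip; case_of_)
open import Function.Bundles using (_⇔_; mk⇔; mk↔ₛ′; module Inverse; module Equivalence)
open import Function.Definitions using (Injective; Surjective)
open import Level using (0ℓ)
open import Relation.Binary using (Rel; IsStrictTotalOrder; tri<; tri≈; tri>; Trichotomous)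
open import Relation.Binary.Construct.Closure.ReflexiveTransitive using (Star; ε; _◅_)
import Relation.Binary.Construct.Flip.EqAndOrd as Flip
open import Relation.Binary.PropositionalEquality as ≡ using (_≡_; _≢_; refl; cong; subst; subst₂)
open import Relation.Binary.Structures.Biased using (isStrictTotalOrderᶜ)
open import Relation.Nullary using (¬_; Dec; yes; no; contradiction; does)
open import Relation.Nullary.Decidable using (map′; _⊎-dec_; toSum; dec-true)
open import Relation.Unary using (Decidable)
open import Defs

-- Embeddings of rooted trees in acyclic graphs

infix 4 _↣_

-- Non-edges need not be preserved: for a tree inside an acyclic graph this is automatic, by
-- `reflects`.
record _↣_ {V W : Set} (G : Graph V) (H : Graph W) : Set where
  private
    module G = Graph G
    module H = Graph H
  field
    to        : V → W
    injective : Injective _≡_ _≡_ to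
    hom       : ∀ {u v} → u G.~ v → to u H.~ to v

open _↣_

infixr 9 _∘ᵉ_

_∘ᵉ_ : ∀ {U V W} {F : Graph U} {G : Graph V} {H : Graph W} → G ↣ H → F ↣ G → F ↣ H
g ∘ᵉ f = record
  { to        = to g ∘ to f
  ; injective = injective f ∘ injective g
  ; hom       = hom g ∘ hom f
  }

inˡ : ∀ {t s} → graph t ↣ graph (t ◂ s)
inˡ = record { to = inj₁ ; injective = inj₁-injective ; hom = id }

inʳ : ∀ {t s} → graph s ↣ graph (t ◂ s)
inʳ = record { to = inj₂ ; injective = inj₂-injective ; hom = id }

point : ∀ {V} {G : Graph V} → V → graph • ↣ G
point v = record { to = λ _ → v ; injective = λ _ → refl ; hom = λ () }

module _ {V : Set} {G : Graph V} where
  open Graph G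

  glue : ∀ {t s} (f : graph t ↣ G) (g : graph s ↣ G) →
         to f (root t) ~ to g (root s) → (∀ u v → to f u ≢ to g v) →
         graph (t ◂ s) ↣ G
  glue {t} {s} f g e disjoint = record { to = h ; injective = inj ; hom = λ {u} {v} → homo {u} {v} }
    where
    h : Vertex (t ◂ s) → V
    h = [ to f , to g ]

    inj : Injective _≡_ _≡_ h
    inj {inj₁ u} {inj₁ v} p = cong inj₁ (injective f p)
    inj {inj₁ u} {inj₂ v} p = contradiction p (disjoint u v)
    inj {inj₂ u} {inj₁ v} p = contradiction (≡.sym p) (disjoint v u)
    inj {inj₂ u} {inj₂ v} p = cong inj₂ (injective g p)

    homo : ∀ {u v} → Edge (t ◂ s) u v → h u ~ h v
    homo {inj₁ u} {inj₁ v} p             = hom f p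
    homo {inj₁ u} {inj₂ v} (refl , refl) = e
    homo {inj₂ u} {inj₁ v} (refl , refl) = sym e
    homo {inj₂ u} {inj₂ v} p             = hom g p

-- Trails, simple paths and cycles

data Trail {V} (G : Graph V) : V → List V → V → Set where
  []  : ∀ {u} → Trail G u [] u
  _∷_ : ∀ {u v vs w} → Graph._~_ G u v → Trail G v vs w → Trail G u (v ∷ vs) w

infixr 5 _++[_]_

_++[_]_ : ∀ {V} {G : Graph V} {u us v w ws x} →
          Trail G u us v → Graph._~_ G v w → Trail G w ws x → Trail G u (us ++ w ∷ ws) x
[]      ++[ e ] q = e ∷ q
(d ∷ p) ++[ e ] q = d ∷ (p ++[ e ] q)

mapᵗ : ∀ {V W} {G : Graph V} {H : Graph W} (f : G ↣ H) {u us v} →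
       Trail G u us v → Trail H (to f u) (List.map (to f) us) (to f v)
mapᵗ f []      = []
mapᵗ f (e ∷ p) = hom f e ∷ mapᵗ f p

SimplePath : ∀ {V} → Graph V → V → V → Set
SimplePath G u v = ∃ λ vs → Trail G u vs v × Unique (u ∷ vs)

mapˢ : ∀ {V W} {G : Graph V} {H : Graph W} (f : G ↣ H) {u v} →
       SimplePath G u v → SimplePath H (to f u) (to f v)
mapˢ f (vs , p , uniq) = List.map (to f) vs , mapᵗ f p , map⁺ (injective f) uniq

images-disjoint : ∀ {A B : Set} {xs : List A} {ys : List B} {z} →
                  z ∈ List.map inj₁ xs → z ∈ List.map inj₂ ys → ⊥
images-disjoint p q with ∈-map⁻ inj₁ p | ∈-map⁻ inj₂ q
... | _ , _ , refl | _ , _ , ()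

simplePath : ∀ t u v → SimplePath (graph t) u v
simplePath •       _        _        = [] , [] , ([] ∷ [])
simplePath (t ◂ s) (inj₁ u) (inj₁ v) = mapˢ inˡ (simplePath t u v)
simplePath (t ◂ s) (inj₂ u) (inj₂ v) = mapˢ inʳ (simplePath s u v)
simplePath (t ◂ s) (inj₁ u) (inj₂ v) =
  let us , p , pu = mapˢ inˡ (simplePath t u (root t))
      vs , q , qu = mapˢ inʳ (simplePath s (root s) v)
  in _ , (p ++[ refl , refl ] q) , ++⁺ pu qu (uncurry images-disjoint)
simplePath (t ◂ s) (inj₂ u) (inj₁ v) =
  let us , p , pu = mapˢ inʳ (simplePath s u (root s))
      vs , q , qu = mapˢ inˡ (simplePath t (root t) v)
  in _ , (p ++[ refl , refl ] q) , ++⁺ pu qu (uncurry (flip images-disjoint))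

lookup-injective : ∀ {A : Set} {xs : List A} → Unique xs → Injective _≡_ _≡_ (lookup xs)
lookup-injective {xs = _ ∷ _}  uniq       {zero}  {zero}  p    = refl
lookup-injective {xs = _ ∷ xs} uniq       {zero}  {suc j} refl =
  contradiction (∈-lookup j) (Unique[x∷xs]⇒x∉xs uniq)
lookup-injective {xs = _ ∷ xs} uniq       {suc i} {zero}  refl =
  contradiction (∈-lookup i) (Unique[x∷xs]⇒x∉xs uniq)
lookup-injective {xs = _ ∷ _}  (_ ∷ uniq) {suc i} {suc j} p    =
  cong suc (lookup-injective uniq p)

module _ {V : Set} {G : Graph V} where
  open Graph G

  trail-step : ∀ {u vs w} → Trail G u vs w → (i : Fin (length vs)) →
               lookup (u ∷ vs) (inject₁ i) ~ lookup (u ∷ vs) (suc i)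
  trail-step (e ∷ p) zero    = e
  trail-step (e ∷ p) (suc i) = trail-step p i

  trail-last : ∀ {u vs w} → Trail G u vs w → lookup (u ∷ vs) (fromℕ (length vs)) ≡ w
  trail-last []      = refl
  trail-last (e ∷ p) = trail-last p

  cycle : ∀ {u a b vs w} → Trail G u (a ∷ b ∷ vs) w → Unique (u ∷ a ∷ b ∷ vs) → w ~ u → Cycle G
  cycle {u} {a} {b} {vs} p uniq e = record
    { k         = length vs
    ; vertex    = lookup (u ∷ a ∷ b ∷ vs)
    ; injective = lookup-injective uniq
    ; step      = trail-step p
    ; close     = subst (_~ u) (≡.sym (trail-last p)) e
    }

  -- The image of the simple path from `u` to `v` in the tree, closed by the given edge, would be a
  -- cycle if the path had two or more edges.
  reflects : ¬ Cycle G → ∀ {t} (f : graph t ↣ G) {u v} → to f u ~ to f v → Edge t u v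
  reflects acyclic {t} f {u} {v} e with simplePath t u v
  ... | []         , []     , _    = ⊥-elim (irrefl e)
  ... | _ ∷ []     , d ∷ [] , _    = d
  ... | _ ∷ _ ∷ _  , p      , uniq =
    ⊥-elim (acyclic (cycle (mapᵗ f p) (map⁺ (injective f) uniq) (sym e)))

-- Covering a connected graph by a rooted tree

any? : ∀ t {P : Vertex t → Set} → Decidable P → Dec (∃ P)
any? •       P? = map′ (tt ,_) proj₂ (P? tt)
any? (t ◂ s) P? =
  map′ [ (λ (u , p) → inj₁ u , p) , (λ (v , p) → inj₂ v , p) ]
       (λ { (inj₁ u , p) → inj₁ (u , p) ; (inj₂ v , p) → inj₂ (v , p) })
       (any? t (P? ∘ inj₁) ⊎-dec any? s (P? ∘ inj₂))

module _ {V : Set} {G : Graph V} where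
  open Graph G

  -- Only what the recursion in `attach` uses is recorded: `rooted` allows the enlarged subtree to
  -- be glued back by its root, and `within` keeps it disjoint from the other subtree.
  record Extension {t} (f : graph t ↣ G) (x : V) : Set where
    field
      tree    : RootedTree
      emb     : graph tree ↣ G
      rooted  : to emb (root tree) ≡ to f (root t)
      extends : ∀ u → ∃ λ w → to emb w ≡ to f u
      hits    : ∃ λ w → to emb w ≡ x
      within  : ∀ w → to emb w ≡ x ⊎ ∃ λ u → to emb w ≡ to f u

  attach : ∀ t (f : graph t ↣ G) u {x} → to f u ~ x → (∀ v → to f v ≢ x) → Extension f x
  attach • f tt {x} e new = record
    { tree    = • ◂ •
    ; emb     = glue f (point x) e λ v _ → new v
    ; rooted  = refl
    ; extends = λ u → inj₁ u , refl
    ; hits    = inj₂ tt , refl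
    ; within  = λ { (inj₁ u) → inj₂ (u , refl) ; (inj₂ _) → inj₁ refl }
    }
  attach (t ◂ s) f (inj₁ u) {x} e new = record
    { tree    = E.tree ◂ s
    ; emb     = glue E.emb (f ∘ᵉ inʳ)
                  (subst (_~ _) (≡.sym E.rooted) (hom f {inj₁ (root t)} {inj₂ (root s)} (refl , refl)))
                  disjoint
    ; rooted  = E.rooted
    ; extends = λ { (inj₁ v) → let w , p = E.extends v in inj₁ w , p
                  ; (inj₂ v) → inj₂ v , refl }
    ; hits    = let w , p = E.hits in inj₁ w , p
    ; within  = λ { (inj₁ w) → Sum.map₂ (λ (v , p) → inj₁ v , p) (E.within w)
                  ; (inj₂ v) → inj₂ (inj₂ v , refl) }
    }
    where
    module E = Extension (attach t (f ∘ᵉ inˡ) u e (new ∘ inj₁))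
    disjoint : ∀ w v → to E.emb w ≢ to f (inj₂ v)
    disjoint w v p with E.within w
    ... | inj₁ q       = new (inj₂ v) (≡.trans (≡.sym p) q)
    ... | inj₂ (v′ , q) with injective f {inj₁ v′} {inj₂ v} (≡.trans (≡.sym q) p)
    ... | ()
  attach (t ◂ s) f (inj₂ u) {x} e new = record
    { tree    = t ◂ E.tree
    ; emb     = glue (f ∘ᵉ inˡ) E.emb
                  (subst (_ ~_) (≡.sym E.rooted) (hom f {inj₁ (root t)} {inj₂ (root s)} (refl , refl)))
                  (λ v w → disjoint w v ∘ ≡.sym)
    ; rooted  = refl
    ; extends = λ { (inj₁ v) → inj₁ v , refl
                  ; (inj₂ v) → let w , p = E.extends v in inj₂ w , p }
    ; hits    = let w , p = E.hits in inj₂ w , p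
    ; within  = λ { (inj₁ v) → inj₂ (inj₁ v , refl)
                  ; (inj₂ w) → Sum.map₂ (λ (v , p) → inj₂ v , p) (E.within w) }
    }
    where
    module E = Extension (attach s (f ∘ᵉ inʳ) u e (new ∘ inj₂))
    disjoint : ∀ w v → to E.emb w ≢ to f (inj₁ v)
    disjoint w v p with E.within w
    ... | inj₁ q       = new (inj₁ v) (≡.trans (≡.sym p) q)
    ... | inj₂ (v′ , q) with injective f {inj₂ v′} {inj₁ v} (≡.trans (≡.sym q) p)
    ... | ()

Covering : ∀ {V} → Graph V → List V → Set
Covering G vs = ∃ λ t → ∃ λ (f : graph t ↣ G) → ∀ {v} → v ∈ vs → ∃ λ u → to f u ≡ v

module _ {n : ℕ} (G : Graph (Fin n)) where
  open Graph G

  -- Induction on the walk: a vertex already in the image is passed over, any other is attached to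
  -- its predecessor on the walk.
  reach : ∀ {t} (f : graph t ↣ G) u {x v} → to f u ≡ x → Star _~_ x v →
          ∃ λ t′ → ∃ λ (f′ : graph t′ ↣ G) →
            (∀ w → ∃ λ w′ → to f′ w′ ≡ to f w) × ∃ λ w → to f′ w ≡ v
  reach {t} f u eq ε = t , f , (λ w → w , refl) , (u , eq)
  reach {t} f u eq (_◅_ {j = y} e p) with any? t (λ w → to f w Fin.≟ y)
  ... | yes (w , eq′) = reach f w eq′ p
  ... | no new =
    let w , q               = E.hits
        t′ , f′ , ext , hit = reach E.emb w q p
    in t′ , f′ , (λ v → let w₁ , p₁ = E.extends v
                            w₂ , p₂ = ext w₁
                        in w₂ , ≡.trans p₂ p₁) , hit
    where
    extension : Extension f y
    extension = attach t f u (subst (_~ y) (≡.sym eq) e) λ w q → new (w , q)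
    module E = Extension extension

  cover : IsTree G → ∀ vs → Covering G vs
  cover T []       = • , point (IsTree.nonempty T) , λ ()
  cover T (v ∷ vs) =
    let t , f , c             = cover T vs
        t′ , f′ , ext , w , p = reach f (root t) refl (IsTree.connected T _ v)
    in t′ , f′ , λ { (here refl) → w , p
                   ; (there q)   → let u , r = c q
                                       u′ , r′ = ext u
                                   in u′ , ≡.trans r′ r }

-- Isomorphisms of rooted trees

infix 4 _≃_ _≃ᵣ_

record _≃_ (t s : RootedTree) : Set where
  field
    fwd     : graph t ↣ graph s
    bwd     : graph s ↣ graph t
    bwd-fwd : ∀ u → to bwd (to fwd u) ≡ u
    fwd-bwd : ∀ u → to fwd (to bwd u) ≡ u

open _≃_

record _≃ᵣ_ (t s : RootedTree) : Set where
  field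
    iso      : t ≃ s
    fwd-root : to (fwd iso) (root t) ≡ root s

  bwd-root : to (bwd iso) (root s) ≡ root t
  bwd-root = ≡.trans (cong (to (bwd iso)) (≡.sym fwd-root)) (bwd-fwd iso (root t))

open _≃ᵣ_

≃-sym : ∀ {t s} → t ≃ s → s ≃ t
≃-sym i = record { fwd = bwd i ; bwd = fwd i ; bwd-fwd = fwd-bwd i ; fwd-bwd = bwd-fwd i }

≃-trans : ∀ {t s r} → t ≃ s → s ≃ r → t ≃ r
≃-trans i j = record
  { fwd     = fwd j ∘ᵉ fwd i
  ; bwd     = bwd i ∘ᵉ bwd j
  ; bwd-fwd = λ u → ≡.trans (cong (to (bwd i)) (bwd-fwd j _)) (bwd-fwd i u)
  ; fwd-bwd = λ u → ≡.trans (cong (to (fwd j)) (fwd-bwd i _)) (fwd-bwd j u)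
  }

≃ᵣ-refl : ∀ {t} → t ≃ᵣ t
≃ᵣ-refl = record
  { iso      = record
    { fwd     = record { to = id ; injective = id ; hom = id }
    ; bwd     = record { to = id ; injective = id ; hom = id }
    ; bwd-fwd = λ _ → refl
    ; fwd-bwd = λ _ → refl
    }
  ; fwd-root = refl
  }

≃ᵣ-sym : ∀ {t s} → t ≃ᵣ s → s ≃ᵣ t
≃ᵣ-sym i = record { iso = ≃-sym (iso i) ; fwd-root = bwd-root i }

≃ᵣ-trans : ∀ {t s r} → t ≃ᵣ s → s ≃ᵣ r → t ≃ᵣ r
≃ᵣ-trans i j = record
  { iso      = ≃-trans (iso i) (iso j)
  ; fwd-root = ≡.trans (cong (to (fwd (iso j))) (fwd-root i)) (fwd-root j)
  }

turn : ∀ {t s} → graph (t ◂ s) ↣ graph (s ◂ t)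
turn = glue inʳ inˡ (refl , refl) λ _ _ ()

◂-comm : ∀ t s → t ◂ s ≃ s ◂ t
◂-comm t s = record
  { fwd     = turn
  ; bwd     = turn
  ; bwd-fwd = λ { (inj₁ _) → refl ; (inj₂ _) → refl }
  ; fwd-bwd = λ { (inj₁ _) → refl ; (inj₂ _) → refl }
  }

exchange : ∀ {t s r} → graph (t ◂ s ◂ r) ↣ graph (t ◂ r ◂ s)
exchange = glue (glue (inˡ ∘ᵉ inˡ) inʳ (refl , refl) λ _ _ ()) (inˡ ∘ᵉ inʳ) (refl , refl)
  λ { (inj₁ _) _ () ; (inj₂ _) _ () }

◂-swap : ∀ t s r → t ◂ s ◂ r ≃ᵣ t ◂ r ◂ s
◂-swap t s r = record
  { iso      = record
    { fwd     = exchange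
    ; bwd     = exchange
    ; bwd-fwd = λ { (inj₁ (inj₁ _)) → refl ; (inj₁ (inj₂ _)) → refl ; (inj₂ _) → refl }
    ; fwd-bwd = λ { (inj₁ (inj₁ _)) → refl ; (inj₁ (inj₂ _)) → refl ; (inj₂ _) → refl }
    }
  ; fwd-root = refl
  }

rotate : ∀ {t s r} → graph (t ◂ (s ◂ r)) ↣ graph (s ◂ t ◂ r)
rotate = glue (inˡ ∘ᵉ inʳ) (glue (inˡ ∘ᵉ inˡ) inʳ (refl , refl) λ _ _ ()) (refl , refl)
  λ { _ (inj₁ _) () ; _ (inj₂ _) () }

unrotate : ∀ {t s r} → graph (s ◂ t ◂ r) ↣ graph (t ◂ (s ◂ r))
unrotate = glue (glue (inʳ ∘ᵉ inˡ) inˡ (refl , refl) λ _ _ ()) (inʳ ∘ᵉ inʳ) (refl , refl)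
  λ { (inj₁ _) _ () ; (inj₂ _) _ () }

-- The root moves across an edge, from `t` to `s`; hence `≃` and not `≃ᵣ`.
◂-rotate : ∀ t s r → t ◂ (s ◂ r) ≃ s ◂ t ◂ r
◂-rotate t s r = record
  { fwd     = rotate
  ; bwd     = unrotate
  ; bwd-fwd = λ { (inj₁ _) → refl ; (inj₂ (inj₁ _)) → refl ; (inj₂ (inj₂ _)) → refl }
  ; fwd-bwd = λ { (inj₁ (inj₁ _)) → refl ; (inj₁ (inj₂ _)) → refl ; (inj₂ _) → refl }
  }

-- Embeddings that fix the root can be combined along `◂`, so a forbidden tree can be assembled
-- branch by branch.
infix 4 _↪_

record _↪_ (t s : RootedTree) : Set where
  field
    emb    : graph t ↣ graph s
    rooted : to emb (root t) ≡ root s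

open _↪_

≃⇒↪ : ∀ {t s} → t ≃ᵣ s → t ↪ s
≃⇒↪ i = record { emb = fwd (iso i) ; rooted = fwd-root i }

↪-trans : ∀ {t s r} → t ↪ s → s ↪ r → t ↪ r
↪-trans f g = record
  { emb    = emb g ∘ᵉ emb f
  ; rooted = ≡.trans (cong (to (emb g)) (rooted f)) (rooted g)
  }

↪-refl : ∀ {t} → t ↪ t
↪-refl = ≃⇒↪ ≃ᵣ-refl

•↪ : ∀ t → • ↪ t
•↪ t = record { emb = point (root t) ; rooted = refl }

↪-weaken : ∀ {t t′} s → t ↪ t′ → t ↪ t′ ◂ s
↪-weaken s f = record { emb = inˡ ∘ᵉ emb f ; rooted = cong inj₁ (rooted f) }

_◂ᵉ_ : ∀ {t t′ s s′} → t ↪ t′ → s ↪ s′ → t ◂ s ↪ t′ ◂ s′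
f ◂ᵉ g = record
  { emb    = glue (inˡ ∘ᵉ emb f) (inʳ ∘ᵉ emb g) (rooted f , rooted g) λ _ _ ()
  ; rooted = cong inj₁ (rooted f)
  }

◂-congˡ : ∀ {t t′} s → t ≃ᵣ t′ → t ◂ s ≃ᵣ t′ ◂ s
◂-congˡ s i = record
  { iso      = record
    { fwd     = emb (≃⇒↪ i ◂ᵉ ↪-refl {s})
    ; bwd     = emb (≃⇒↪ (≃ᵣ-sym i) ◂ᵉ ↪-refl {s})
    ; bwd-fwd = λ { (inj₁ u) → cong inj₁ (bwd-fwd (iso i) u) ; (inj₂ _) → refl }
    ; fwd-bwd = λ { (inj₁ u) → cong inj₁ (fwd-bwd (iso i) u) ; (inj₂ _) → refl }
    }
  ; fwd-root = cong inj₁ (fwd-root i)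
  }

-- Layouts of acyclic graphs

-- Unlike `ProperlyThin`, this allows empty classes, so that small pieces can be laid out and glued;
-- `claw⇒surjective` restores surjectivity at the end.
record Layout {V : Set} (G : Graph V) (C : Set) : Set₁ where
  infix 4 _<_
  field
    _<_                : Rel V 0ℓ
    class              : V → C
    isStrictTotalOrder : IsStrictTotalOrder _≡_ _<_
    consistent         : StronglyConsistent G _<_ class

  open IsStrictTotalOrder isStrictTotalOrder public
    using (compare; asym) renaming (trans to <-trans; irrefl to <-irrefl)

reverse : ∀ {V C} {G : Graph V} → Layout G C → Layout G C
reverse {G = G} L = record
  { _<_                = flip _<_
  ; class              = class
  ; isStrictTotalOrder = Flip.isStrictTotalOrder isStrictTotalOrder
  ; consistent         = λ r>s s>t r~t →
      let st , rs = consistent s>t r>s (sym r~t)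
      in (λ p → sym (rs (≡.sym p))) , λ p → sym (st (≡.sym p))
  }
  where
  open Layout L
  open Graph G

Unique-resp-⊆ : ∀ {A : Set} {xs ys : List A} → xs ⊆ ys → Unique ys → Unique xs
Unique-resp-⊆ []           []          = []
Unique-resp-⊆ (_ ∷ʳ p)     (_ ∷ uniq)  = Unique-resp-⊆ p uniq
Unique-resp-⊆ (refl ∷ p)   (ne ∷ uniq) = All-resp-⊆ p ne ∷ Unique-resp-⊆ p uniq

-- The result is a sublist of exact length, so that distinctness and other properties of the
-- elements pass to it.
pigeonhole : ∀ {A : Set} {P Q : A → Set} m n xs → All (λ x → P x ⊎ Q x) xs → m + n ≤ suc (length xs) →
             (∃ λ ys → ys ⊆ xs × All P ys × length ys ≡ m) ⊎
             (∃ λ ys → ys ⊆ xs × All Q ys × length ys ≡ n)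
pigeonhole zero    n       xs       _              _       = inj₁ ([] , minimum xs , [] , refl)
pigeonhole (suc m) zero    xs       _              _       = inj₂ ([] , minimum xs , [] , refl)
pigeonhole (suc m) (suc n) []       _              (s≤s p) with subst (_≤ 0) (+-suc m n) p
... | ()
pigeonhole (suc m) (suc n) (x ∷ xs) (inj₁ px ∷ ps) (s≤s p) =
  Sum.map (λ (ys , s , a , l) → x ∷ ys , refl ∷ s , px ∷ a , cong suc l)
          (λ (ys , s , a , l) → ys , x ∷ʳ s , a , l)
          (pigeonhole m (suc n) xs ps p)
pigeonhole (suc m) (suc n) (x ∷ xs) (inj₂ qx ∷ ps) (s≤s p) =
  Sum.map (λ (ys , s , a , l) → ys , x ∷ʳ s , a , l)
          (λ (ys , s , a , l) → x ∷ ys , refl ∷ s , qx ∷ a , cong suc l)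
          (pigeonhole (suc m) n xs ps (subst (_≤ suc (length xs)) (+-suc m n) p))

record Claw {V} (G : Graph V) (v : V) : Set where
  open Graph G
  field
    {x y z}     : V
    v~x         : v ~ x
    v~y         : v ~ y
    v~z         : v ~ z
    x≢y         : x ≢ y
    x≢z         : x ≢ z
    y≢z         : y ≢ z

mapᶜ : ∀ {V W} {G : Graph V} {H : Graph W} (f : G ↣ H) {v} → Claw G v → Claw H (to f v)
mapᶜ f k = record
  { v~x = hom f v~x ; v~y = hom f v~y ; v~z = hom f v~z
  ; x≢y = x≢y ∘ injective f ; x≢z = x≢z ∘ injective f ; y≢z = y≢z ∘ injective f }
  where
  open Claw k

module Acyclic {V : Set} (G : Graph V) (acyclic : ¬ Cycle G) where
  open Graph G

  ~⇒≢ : ∀ {a b} → a ~ b → a ≢ b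
  ~⇒≢ e refl = irrefl e

  triangle : ∀ {a b c} → a ~ b → b ~ c → ¬ (a ~ c)
  triangle ab bc ac = acyclic (cycle (ab ∷ bc ∷ [])
    ((~⇒≢ ab ∷ ~⇒≢ ac ∷ []) ∷ (~⇒≢ bc ∷ []) ∷ [] ∷ []) (sym ac))

  square : ∀ {a b c d} → a ~ b → b ~ c → c ~ d → d ~ a → a ≢ c → b ≢ d → ⊥
  square ab bc cd da a≢c b≢d = acyclic (cycle (ab ∷ bc ∷ cd ∷ [])
    ((~⇒≢ ab ∷ a≢c ∷ ~⇒≢ (sym da) ∷ []) ∷ (~⇒≢ bc ∷ b≢d ∷ []) ∷ (~⇒≢ cd ∷ []) ∷ [] ∷ []) da)

  module Order {C : Set} (L : Layout G C) where
    open Layout L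

    left : ∀ {r s t} → r < s → s < t → r ~ t → class r ≡ class s → s ~ t
    left p q e = proj₁ (consistent p q e)

    right : ∀ {r s t} → r < s → s < t → r ~ t → class s ≡ class t → r ~ s
    right p q e = proj₂ (consistent p q e)

    <⇒≢ : ∀ {a b} → a < b → a ≢ b
    <⇒≢ p q = <-irrefl q p

    side : ∀ {a v} → a ≢ v → a < v ⊎ v < a
    side {a} {v} a≢v with compare a v
    ... | tri< p _ _ = inj₁ p
    ... | tri≈ _ p _ = contradiction p a≢v
    ... | tri> _ _ p = inj₂ p

    -- If `a < b < v`, the edge from `a` to `v` passes over `b`, which has the class of `v`;
    -- consistency then makes `a` and `b` adjacent and closes a triangle.
    below-unique : ∀ {a b v} → v ~ a → v ~ b → class a ≡ class v → class b ≡ class v →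
                   a < v → b < v → a ≡ b
    below-unique {a} {b} va vb ca cb a<v b<v with compare a b
    ... | tri≈ _ p _   = p
    ... | tri< a<b _ _ = ⊥-elim (triangle (right a<b b<v (sym va) cb) (sym vb) (sym va))
    ... | tri> _ _ b<a = ⊥-elim (triangle (right b<a a<v (sym vb) ca) (sym va) (sym vb))

  module _ {C : Set} (L : Layout G C) where
    open Layout L
    open Order L

    opposite : ∀ {a b v} → v ~ a → v ~ b → class a ≡ class v → class b ≡ class v → a ≢ b →
               (a < v × v < b) ⊎ (b < v × v < a)
    opposite va vb ca cb a≢b with side (~⇒≢ (sym va)) | side (~⇒≢ (sym vb))
    ... | inj₁ p | inj₁ q = contradiction (below-unique va vb ca cb p q) a≢b
    ... | inj₁ p | inj₂ q = inj₁ (p , q)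
    ... | inj₂ p | inj₁ q = inj₂ (q , p)
    ... | inj₂ p | inj₂ q = contradiction (Order.below-unique (reverse L) va vb ca cb p q) a≢b

    -- Three neighbours in the class of `v` would lie pairwise on opposite sides of `v`. The number
    -- of classes is arbitrary: with one class this gives the lower bound 2 in the theorem.
    claw-bichromatic : ∀ {v} (k : Claw G v) →
                       ¬ (class (Claw.x k) ≡ class v × class (Claw.y k) ≡ class v ×
                          class (Claw.z k) ≡ class v)
    claw-bichromatic k (cx , cy , cz)
      with opposite v~x v~y cx cy x≢y | opposite v~x v~z cx cz x≢z | opposite v~y v~z cy cz y≢z
      where
      open Claw k
    ... | inj₁ (p , _) | inj₂ (_ , q) | _            = asym p q
    ... | inj₂ (_ , p) | inj₁ (q , _) | _            = asym p q
    ... | inj₁ (_ , p) | inj₁ (_ , _) | inj₁ (q , _) = asym p q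
    ... | inj₁ (_ , _) | inj₁ (_ , p) | inj₂ (q , _) = asym p q
    ... | inj₂ (_ , _) | inj₂ (p , _) | inj₁ (_ , q) = asym p q
    ... | inj₂ (p , _) | inj₂ (_ , _) | inj₂ (_ , q) = asym p q

  other-class : ∀ {x y z : Fin 2} → x ≢ y → z ≢ y → z ≡ x
  other-class {zero}     {zero}     {_}        x≢y _   = contradiction refl x≢y
  other-class {suc zero} {suc zero} {_}        x≢y _   = contradiction refl x≢y
  other-class {zero}     {suc zero} {zero}     _   _   = refl
  other-class {zero}     {suc zero} {suc zero} _   z≢y = contradiction refl z≢y
  other-class {suc zero} {zero}     {zero}     _   z≢y = contradiction refl z≢y
  other-class {suc zero} {zero}     {suc zero} _   _   = refl

  module _ (L : Layout G (Fin 2)) where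
    open Layout L
    open Order L

    -- An edge between different classes cannot jump over u unless one of its ends is adjacent
    -- to u.  So p and q have the class opposite to u, and u has no neighbour in that class.
    no-crossing : ∀ {p u q} → Claw G u → p ~ q → ¬ (p ~ u) → ¬ (u ~ q) → p < u → ¬ (u < q)
    no-crossing {p} {u} {q} k pq ¬py ¬yq p<u u<q =
      claw-bichromatic L k (same-class v~x , same-class v~y , same-class v~z)
      where
      open Claw k
      p≢u : class p ≢ class u
      p≢u e = ¬yq (left p<u u<q pq e)
      q≢u : class q ≢ class u
      q≢u e = ¬py (right p<u u<q pq (≡.sym e))
      p≡q : class p ≡ class q
      p≡q = other-class q≢u p≢u
      -- A neighbour `n` in this class cannot lie before `p` or after `q`, as its edge to `u` would
      -- pass over `p` or `q` and make that end adjacent to `u`. Between `p` and `q` it would be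
      -- adjacent to both.
      no-other : ∀ {n} → u ~ n → class n ≢ class p
      no-other {n} yn e with compare n p | compare n q
      ... | tri< n<p _ _  | _             = ¬py (left n<p p<u (sym yn) e)
      ... | tri≈ _ refl _ | _             = ¬py (sym yn)
      ... | tri> _ _ _    | tri≈ _ refl _ = ¬yq yn
      ... | tri> _ _ _    | tri> _ _ q<n  = ¬yq (right u<q q<n yn (≡.trans (≡.sym p≡q) (≡.sym e)))
      ... | tri> _ _ p<n  | tri< n<q _ _  =
        triangle (right p<n n<q pq (≡.trans e p≡q)) (left p<n n<q pq (≡.sym e)) pq
      same-class : ∀ {n} → u ~ n → class n ≡ class u
      same-class {n} yn with class n Fin.≟ class u
      ... | yes e = e
      ... | no ne = contradiction (other-class p≢u ne) (no-other yn)

    -- The situation left open by `no-crossing`: `u` is itself adjacent to `c`, so edges at `c` may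
    -- pass over it.
    record Enclosed (c u p q : V) : Set where
      field
        u~c : u ~ c
        p~c : p ~ c
        q~c : q ~ c
        p<u : p < u
        u<q : u < q

  mirror : ∀ {L c u p q} → Enclosed L c u p q → Enclosed (reverse L) c u q p
  mirror E = record { u~c = u~c ; p~c = q~c ; q~c = p~c ; p<u = u<q ; u<q = p<u }
    where
    open Enclosed E

  -- Here the edge from `p` to `c` passes over `u`. The case `c < u` follows by `reverse` and
  -- `mirror`.
  module LeftOfCentre (L : Layout G (Fin 2)) {c u p q : V} (E : Enclosed L c u p q)
                      (u<c : Layout._<_ L u c) where
    open Layout L
    open Order L
    open Enclosed E

    c≢u : class c ≢ class u
    c≢u e = triangle (right p<u u<c p~c (≡.sym e)) u~c p~c

    same-class-right : ∀ {d} → u ~ d → d ≢ c → class d ≡ class u → u < d → c < d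
    same-class-right ud d≢c e u<d with side d≢c
    ... | inj₁ d<c = ⊥-elim (triangle ud (left u<d d<c u~c (≡.sym e)) u~c)
    ... | inj₂ c<d = c<d

    -- If `d < c`, then either the edge from `p` to `c` passes over `d`, or the edge from `d` to `u`
    -- passes over `p`. In each case an adjacency is forced that closes a triangle or a square.
    other-class-right : ∀ {d} → u ~ d → d ≢ c → class d ≡ class c → c < d
    other-class-right {d} ud d≢c e with side d≢c | compare p d
    ... | inj₂ c<d | _             = c<d
    ... | inj₁ d<c | tri≈ _ refl _ = ⊥-elim (triangle ud p~c u~c)
    ... | inj₁ d<c | tri< p<d _ _  =
      ⊥-elim (square (right p<d d<c p~c e) (sym ud) u~c (sym p~c) (<⇒≢ p<u) d≢c)
    ... | inj₁ d<c | tri> _ _ d<p with class p Fin.≟ class u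
    ...   | yes e′ = ⊥-elim (square (right d<p p<u (sym ud) e′) p~c (sym u~c) ud d≢c (<⇒≢ p<u))
    ...   | no ne  = ⊥-elim
      (triangle (left d<p p<u (sym ud) (≡.trans e (≡.sym (other-class c≢u ne)))) u~c p~c)

    -- Otherwise `u < c < d` by `other-class-right`. If `q < d`, the edge from `u` to `d` passes
    -- over `q`; if `d < q`, the edge from `c` to `q` passes over `d`. Both close a triangle or a
    -- square.
    same-class : ∀ {d} → u ~ d → d ≢ c → class d ≡ class u
    same-class {d} ud d≢c with class d Fin.≟ class u
    ... | yes e = e
    ... | no ne = ⊥-elim impossible
      where
      e : class d ≡ class c
      e = other-class c≢u ne
      c<d : c < d
      c<d = other-class-right ud d≢c e
      impossible : ⊥
      impossible with compare q d | class q Fin.≟ class u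
      ... | tri≈ _ refl _ | _      = triangle ud q~c u~c
      ... | tri< q<d _ _  | yes e′ = square (left u<q q<d ud (≡.sym e′)) (sym ud) u~c (sym q~c) (<⇒≢ u<q ∘ ≡.sym) d≢c
      ... | tri< q<d _ _  | no ne′ =
        triangle (right u<q q<d ud (≡.trans (other-class c≢u ne′) (≡.sym e))) q~c u~c
      ... | tri> _ _ d<q  | _      =
        square (left c<d d<q (sym q~c) (≡.sym e)) q~c (sym u~c) ud d≢c (<⇒≢ u<q ∘ ≡.sym)

    -- If `x` had the class of `u`, it would have that of `d`. The one of `x` and `d` farther from
    -- `u` has an edge, to `c` or to `u`, that passes over the other, and a triangle arises.
    below : ∀ {d x} → u ~ d → d ≢ c → d < u → x ~ c → x < u → class x ≢ class u
    below {d} {x} ud d≢c d<u xc x<u e with compare x d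
    ... | tri< x<d _ _  = triangle (sym ud) u~c
      (left x<d (<-trans d<u u<c) xc (≡.trans e (≡.sym (same-class ud d≢c))))
    ... | tri≈ _ refl _ = triangle ud xc u~c
    ... | tri> _ _ d<x  =
      triangle (left d<x x<u (sym ud) (≡.trans (same-class ud d≢c) (≡.sym e))) u~c xc

    -- As for `below`, but `c` lies on this side too: `same-class-right` puts it before `d`, so that
    -- for `d < x` the edge from `c` to `x` still passes over `d`.
    above : ∀ {d x} → u ~ d → d ≢ c → u < d → x ~ c → u < x → class x ≢ class u
    above {d} {x} ud d≢c u<d xc u<x e with compare x d
    ... | tri< x<d _ _  =
      triangle (right u<x x<d ud (≡.trans e (≡.sym (same-class ud d≢c)))) xc u~c
    ... | tri≈ _ refl _ = triangle ud xc u~c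
    ... | tri> _ _ d<x  = triangle ud (sym
      (right (same-class-right ud d≢c (same-class ud d≢c) u<d) d<x (sym xc)
        (≡.trans (same-class ud d≢c) (≡.sym e)))) u~c

    -- Both `d` and `d′` have the class of `u`, so they lie on opposite sides of it; then `below`
    -- and `above` bar that class for `x` on either side.
    centre-class : ∀ {d d′ x} → u ~ d → d ≢ c → u ~ d′ → d′ ≢ c → d ≢ d′ →
                   x ~ c → x ≢ u → class x ≡ class c
    centre-class {d} {d′} {x} ud d≢c ud′ d′≢c d≢d′ xc x≢u with class x Fin.≟ class u
    ... | no ne = other-class c≢u ne
    ... | yes e with opposite L ud ud′ (same-class ud d≢c) (same-class ud′ d′≢c) d≢d′ | side x≢u
    ...   | inj₁ (d<u , u<d′) | inj₁ x<u = contradiction e (below ud d≢c d<u xc x<u)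
    ...   | inj₁ (d<u , u<d′) | inj₂ u<x = contradiction e (above ud′ d′≢c u<d′ xc u<x)
    ...   | inj₂ (d′<u , u<d) | inj₁ x<u = contradiction e (below ud′ d′≢c d′<u xc x<u)
    ...   | inj₂ (d′<u , u<d) | inj₂ u<x = contradiction e (above ud d≢c u<d xc u<x)

  module _ (L : Layout G (Fin 2)) where
    open Layout L
    open Order L

    -- By `same-class` the three neighbours of `u` other than `c` would all have the class of `u`.
    enclosed-degree-4 : ∀ {c u p q} → Enclosed L c u p q → (k : Claw G u) →
                        Claw.x k ≢ c → Claw.y k ≢ c → Claw.z k ≢ c → ⊥
    enclosed-degree-4 E k x≢ y≢ z≢ with side (~⇒≢ (Enclosed.u~c E))
    ... | inj₁ u<c = claw-bichromatic L k (same-class v~x x≢ , same-class v~y y≢ , same-class v~z z≢)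
      where
      open Claw k
      open LeftOfCentre L E u<c
    ... | inj₂ c<u = claw-bichromatic L k (same-class v~x x≢ , same-class v~y y≢ , same-class v~z z≢)
      where
      open Claw k
      open LeftOfCentre (reverse L) (mirror E) c<u

    -- By `centre-class` the neighbours `p`, `q` and `ℓ` of `c` would all have the class of `c`. In
    -- `T₅` the vertex `ℓ` is the leaf at `c`.
    enclosed-centre-degree-4 : ∀ {c u p q ℓ d d′} → Enclosed L c u p q →
                               ℓ ~ c → ℓ ≢ u → ℓ ≢ p → ℓ ≢ q →
                               u ~ d → d ≢ c → u ~ d′ → d′ ≢ c → d ≢ d′ → ⊥
    enclosed-centre-degree-4 {c} {u} {p} {q} {ℓ} E ℓ~c ℓ≢u ℓ≢p ℓ≢q ud d≢c ud′ d′≢c d≢d′ =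
      claw-bichromatic L k (class-of p~c (<⇒≢ p<u) , class-of q~c (<⇒≢ u<q ∘ ≡.sym) , class-of ℓ~c ℓ≢u)
      where
      open Enclosed E
      k : Claw G c
      k = record { v~x = sym p~c ; v~y = sym q~c ; v~z = sym ℓ~c
                 ; x≢y = <⇒≢ (<-trans p<u u<q) ; x≢z = ℓ≢p ∘ ≡.sym ; y≢z = ℓ≢q ∘ ≡.sym }
      class-of : ∀ {x} → x ~ c → x ≢ u → class x ≡ class c
      class-of with side (~⇒≢ u~c)
      ... | inj₁ u<c = LeftOfCentre.centre-class L E u<c ud d≢c ud′ d′≢c d≢d′
      ... | inj₂ c<u = LeftOfCentre.centre-class (reverse L) (mirror E) c<u ud d≢c ud′ d′≢c d≢d′

    -- One of `p` and `q` lies on the same side of `u` as `d`, which `below` or `above` excludes.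
    enclosed-monochromatic-leaf : ∀ {c u p q d} → Enclosed L c u p q →
                                  class p ≡ class u → class q ≡ class u → u ~ d → d ≢ c → ⊥
    enclosed-monochromatic-leaf E p≡u q≡u ud d≢c with side (~⇒≢ (Enclosed.u~c E)) | side (~⇒≢ ud)
    ... | inj₁ u<c | inj₁ u<d = LeftOfCentre.above L E u<c ud d≢c u<d q~c u<q q≡u
      where
      open Enclosed E
    ... | inj₁ u<c | inj₂ d<u = LeftOfCentre.below L E u<c ud d≢c d<u p~c p<u p≡u
      where
      open Enclosed E
    ... | inj₂ c<u | inj₁ u<d = LeftOfCentre.below (reverse L) (mirror E) c<u ud d≢c u<d q~c u<q q≡u
      where
      open Enclosed E
    ... | inj₂ c<u | inj₂ d<u = LeftOfCentre.above (reverse L) (mirror E) c<u ud d≢c d<u p~c p<u p≡u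
      where
      open Enclosed E

    Between : V → V → V → Set
    Between x y z = (x < y × y < z) ⊎ (z < y × y < x)

    middle : ∀ {x y z} → x ≢ y → x ≢ z → y ≢ z → Between y x z ⊎ Between x y z ⊎ Between x z y
    middle x≢y x≢z y≢z with side x≢y | side x≢z | side y≢z
    ... | inj₁ x<y | inj₁ x<z | inj₁ y<z = inj₂ (inj₁ (inj₁ (x<y , y<z)))
    ... | inj₁ x<y | inj₁ x<z | inj₂ z<y = inj₂ (inj₂ (inj₁ (x<z , z<y)))
    ... | inj₁ x<y | inj₂ z<x | _        = inj₁ (inj₂ (z<x , x<y))
    ... | inj₂ y<x | inj₁ x<z | _        = inj₁ (inj₁ (y<x , x<z))
    ... | inj₂ y<x | inj₂ z<x | inj₁ y<z = inj₂ (inj₂ (inj₂ (y<z , z<x)))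
    ... | inj₂ y<x | inj₂ z<x | inj₂ z<y = inj₂ (inj₁ (inj₂ (z<y , y<x)))

    Arm : V → V → Set
    Arm c x = x ~ c × ∃ λ d → x ~ d × d ≢ c

    no-enclosed-arm : ∀ {c u p q} → Arm c p → Arm c u → Arm c q →
                      class p ≢ class c → class u ≢ class c → class q ≢ class c → ¬ Between p u q
    no-enclosed-arm (p~c , _) (u~c , d , u~d , d≢c) (q~c , _) p≢ u≢ q≢ =
      [ (λ (p<u , u<q) → enclosed-monochromatic-leaf
          (record { u~c = u~c ; p~c = p~c ; q~c = q~c ; p<u = p<u ; u<q = u<q })
          (other-class u≢ p≢) (other-class u≢ q≢) u~d d≢c)
      , (λ (q<u , u<p) → enclosed-monochromatic-leaf
          (record { u~c = u~c ; p~c = q~c ; q~c = p~c ; p<u = q<u ; u<q = u<p })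
          (other-class u≢ q≢) (other-class u≢ p≢) u~d d≢c)
      ]

    three-arms : ∀ {c xs} → All (Arm c) xs → Unique xs → length xs ≡ 3 →
                 ¬ All (λ x → class x ≡ class c) xs × ¬ All (λ x → class x ≢ class c) xs
    three-arms {c} {x ∷ y ∷ z ∷ []} (ax ∷ ay ∷ az ∷ []) ((x≢y ∷ x≢z ∷ []) ∷ (y≢z ∷ []) ∷ _) refl =
      (λ { (cx ∷ cy ∷ cz ∷ []) → claw-bichromatic L
             (record { v~x = sym (proj₁ ax) ; v~y = sym (proj₁ ay) ; v~z = sym (proj₁ az)
                     ; x≢y = x≢y ; x≢z = x≢z ; y≢z = y≢z }) (cx , cy , cz) })
      , λ { (cx ∷ cy ∷ cz ∷ []) →
            [ no-enclosed-arm ay ax az cy cx cz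
            , [ no-enclosed-arm ax ay az cx cy cz , no-enclosed-arm ax az ay cx cz cy ] ]
            (middle x≢y x≢z y≢z) }

    at-most-four-arms : ∀ {c xs} → All (Arm c) xs → Unique xs → ¬ (5 ≤ length xs)
    at-most-four-arms {c} {xs} arms uniq 5≤
      -- Here `3 + 3 ≤ 5 + 1`: three of the arms have the class of `c`, or three have the other
      -- class.
      with pigeonhole 3 3 xs (All.universal (λ x → toSum (class x Fin.≟ class c)) xs) (s≤s 5≤)
    ... | inj₁ (ys , ys⊆xs , cs , len) =
      proj₁ (three-arms (All-resp-⊆ ys⊆xs arms) (Unique-resp-⊆ ys⊆xs uniq) len) cs
    ... | inj₂ (ys , ys⊆xs , cs , len) =
      proj₂ (three-arms (All-resp-⊆ ys⊆xs arms) (Unique-resp-⊆ ys⊆xs uniq) len) cs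

-- The forbidden trees have no layout with two classes

centre : ∀ i → Vertex (stem i (star 2))
centre zero    = root (star 2)
centre (suc i) = inj₂ (centre i)

-- The two leaves are only two of the neighbours; the third is the preceding vertex on the path,
-- which is `root a` when the path has length 1.
centre-claw : ∀ a i → Claw (graph (a ◂ stem i (star 2))) (inj₂ (centre i))
centre-claw a zero    = record
  { x = inj₁ (root a) ; y = inj₂ (inj₁ (inj₂ tt)) ; z = inj₂ (inj₂ tt)
  ; v~x = refl , refl ; v~y = refl , refl ; v~z = refl , refl
  ; x≢y = λ () ; x≢z = λ () ; y≢z = λ () }
centre-claw a (suc i) = mapᶜ inʳ (centre-claw • i)

module Refutation {V : Set} (G : Graph V) (acyclic : ¬ Cycle G) (L : Layout G (Fin 2)) where
  open Graph G
  open Layout L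
  open Acyclic G acyclic

  non-adjacent : ∀ {t} (f : graph t ↣ G) u v → ¬ Edge t u v → ¬ (to f u ~ to f v)
  non-adjacent f u v ne e = ne (reflects acyclic f e)

  -- The end of s never lies between two further neighbours of the root of a ◂ s.
  record Separated (a s : RootedTree) : Set where
    field
      end   : Vertex s
      claw  : Claw (graph (a ◂ s)) (inj₂ end)
      apart : ∀ (f : graph (a ◂ s ◂ • ◂ •) ↣ G) →
              let u = to f (inj₁ (inj₁ (inj₂ end))) in
              to f (inj₁ (inj₂ tt)) < u → ¬ (u < to f (inj₂ tt))

  -- The end is at distance at least 2 from the root `c` of `a`. Whichever side of it `c` is on, the
  -- edge from `c` to `p` or `q` on the other side contradicts `no-crossing`.
  far : ∀ a i → Separated a (stem (suc i) (star 2))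
  far a i = record
    { end   = centre (suc i)
    ; claw  = centre-claw a (suc i)
    ; apart = apart
    }
    where
    apart : ∀ (f : graph (a ◂ stem (suc i) (star 2) ◂ • ◂ •) ↣ G) →
            let u = to f (inj₁ (inj₁ (inj₂ (centre (suc i))))) in
            to f (inj₁ (inj₂ tt)) < u → ¬ (u < to f (inj₂ tt))
    apart f p<u u<q = [ crosses-q , crosses-p ] (Order.side L c≢u)
      where
      c = inj₁ (inj₁ (inj₁ (root a)))
      u = inj₁ (inj₁ (inj₂ (centre (suc i))))
      p = inj₁ (inj₂ tt)
      q = inj₂ tt
      c≢u : to f c ≢ to f u
      c≢u e with injective f {c} {u} e
      ... | ()
      crosses-q : ¬ (to f c < to f u)
      crosses-q c<u = no-crossing L (mapᶜ (f ∘ᵉ inˡ ∘ᵉ inˡ) (centre-claw a (suc i)))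
        (hom f {c} {q} (refl , refl)) (non-adjacent f c u λ ()) (non-adjacent f u q λ ()) c<u u<q
      crosses-p : ¬ (to f u < to f c)
      crosses-p u<c = no-crossing L (mapᶜ (f ∘ᵉ inˡ ∘ᵉ inˡ) (centre-claw a (suc i)))
        (hom f {p} {c} (refl , refl)) (non-adjacent f p u λ ()) (non-adjacent f u c λ ()) p<u u<c

  enclosed : ∀ {a s} (f : graph (a ◂ s ◂ • ◂ •) ↣ G) → let u = to f (inj₁ (inj₁ (inj₂ (root s)))) in
             to f (inj₁ (inj₂ tt)) < u → u < to f (inj₂ tt) →
             Enclosed L (to f (inj₁ (inj₁ (inj₁ (root a))))) u (to f (inj₁ (inj₂ tt))) (to f (inj₂ tt))
  enclosed {a} {s} f p<u u<q = record
    { u~c = hom f {inj₁ (inj₁ (inj₂ (root s)))} {inj₁ (inj₁ (inj₁ (root a)))} (refl , refl)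
    ; p~c = hom f {inj₁ (inj₂ tt)} {inj₁ (inj₁ (inj₁ (root a)))} (refl , refl)
    ; q~c = hom f {inj₂ tt} {inj₁ (inj₁ (inj₁ (root a)))} (refl , refl)
    ; p<u = p<u
    ; u<q = u<q
    }

  near-4 : Separated • (star 3)
  near-4 = record
    { end   = root (star 3)
    ; claw  = mapᶜ inʳ leaves
    ; apart = λ f p<u u<q → enclosed-degree-4 L (enclosed f p<u u<q)
                (mapᶜ (f ∘ᵉ inˡ ∘ᵉ inˡ ∘ᵉ inʳ) leaves)
                (λ e → case injective f e of λ ())
                (λ e → case injective f e of λ ())
                (λ e → case injective f e of λ ())
    }
    where
    leaves : Claw (graph (star 3)) (root (star 3))
    leaves = record
      { x = inj₁ (inj₁ (inj₂ tt)) ; y = inj₁ (inj₂ tt) ; z = inj₂ tt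
      ; v~x = refl , refl ; v~y = refl , refl ; v~z = refl , refl
      ; x≢y = λ () ; x≢z = λ () ; y≢z = λ () }

  -- The first argument `• ◂ •` holds `c` together with its leaf `ℓ`, a fourth neighbour of `c`
  -- besides `u`, `p` and `q`.
  near-3 : Separated (• ◂ •) (star 2)
  near-3 = record
    { end   = root (star 2)
    ; claw  = centre-claw (• ◂ •) 0
    ; apart = λ f p<u u<q →
        let ≢-map : ∀ {v w} → v ≢ w → to f v ≢ to f w
            ≢-map v≢w e = v≢w (injective f e)
            ℓ  = inj₁ (inj₁ (inj₁ (inj₂ tt)))
            u  = inj₁ (inj₁ (inj₂ (inj₁ (inj₁ tt))))
            c  = inj₁ (inj₁ (inj₁ (inj₁ tt)))
            d  = inj₁ (inj₁ (inj₂ (inj₁ (inj₂ tt))))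
            d′ = inj₁ (inj₁ (inj₂ (inj₂ tt)))
        in enclosed-centre-degree-4 L (enclosed f p<u u<q)
             (hom f {ℓ} {c} (refl , refl)) (≢-map λ ()) (≢-map λ ()) (≢-map λ ())
             (hom f {u} {d} (refl , refl)) (≢-map λ ())
             (hom f {u} {d′} (refl , refl)) (≢-map λ ()) (≢-map λ ())
    }

  -- A step of the trail to the other side of `u` would contradict `no-crossing`. The layout is a
  -- parameter, so that `reverse L` yields the statement for the side above.
  stays-below : ∀ (L′ : Layout G (Fin 2)) {t u} (f : graph t ↣ G) → Claw G u →
                (∀ v → to f v ≢ u) → (∀ v → ¬ (to f v ~ u)) →
                ∀ {v vs w} → Trail (graph t) v vs w → Layout._<_ L′ (to f v) u → Layout._<_ L′ (to f w) u
  stays-below L′ f k ne na []      v<u = v<u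
  stays-below L′ f k ne na (_∷_ {v = y} e p) v<u = stays-below L′ f k ne na p
    ([ id , (λ u<y → ⊥-elim (no-crossing L′ k (hom f e) (na _) (na _ ∘ sym) v<u u<y)) ]
      (Order.side L′ (ne y)))

  -- The branches `t` and `r` contain neither `u` nor a neighbour of it, so `y` and `z` may be
  -- replaced by the roots of their branches. Then `apart` applies.
  not-between : ∀ {a s t r} (S : Separated a s) (f : graph (a ◂ s ◂ t ◂ r) ↣ G) y z →
                let u = to f (inj₁ (inj₁ (inj₂ (Separated.end S)))) in
                ¬ Between L (to f (inj₁ (inj₂ y))) u (to f (inj₂ z))
  not-between {a} {s} {t} {r} S f y z = [ forwards , backwards ]
    where
    open Separated S
    u : V
    u = to f (inj₁ (inj₁ (inj₂ end)))
    k : Claw G u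
    k = mapᶜ (f ∘ᵉ inˡ ∘ᵉ inˡ) claw
    fₜ : graph t ↣ G
    fₜ = f ∘ᵉ inˡ ∘ᵉ inʳ
    fᵣ : graph r ↣ G
    fᵣ = f ∘ᵉ inʳ
    ne-t : ∀ v → to fₜ v ≢ u
    ne-t v e with injective f e
    ... | ()
    na-t : ∀ v → ¬ (to fₜ v ~ u)
    na-t v = non-adjacent f _ _ λ ()
    ne-r : ∀ v → to fᵣ v ≢ u
    ne-r v e with injective f e
    ... | ()
    na-r : ∀ v → ¬ (to fᵣ v ~ u)
    na-r v = non-adjacent f _ _ λ ()
    -- The branches `t` and `r` are cut down to their roots; `core′` has these two interchanged, for
    -- the reverse order.
    core : graph (a ◂ s ◂ • ◂ •) ↣ G
    core = f ∘ᵉ emb (_◂ᵉ_ {s = •} (_◂ᵉ_ {s = •} (↪-refl {a ◂ s}) (•↪ t)) (•↪ r))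
    core′ : graph (a ◂ s ◂ • ◂ •) ↣ G
    core′ = core ∘ᵉ exchange
    forwards : ¬ (to fₜ y < u × u < to fᵣ z)
    forwards (y<u , u<z) = apart core
      (stays-below L fₜ k ne-t na-t (proj₁ (proj₂ (simplePath t y (root t)))) y<u)
      (stays-below (reverse L) fᵣ k ne-r na-r (proj₁ (proj₂ (simplePath r z (root r)))) u<z)
    backwards : ¬ (to fᵣ z < u × u < to fₜ y)
    backwards (z<u , u<y) = apart core′
      (stays-below L fᵣ k ne-r na-r (proj₁ (proj₂ (simplePath r z (root r)))) z<u)
      (stays-below (reverse L) fₜ k ne-t na-t (proj₁ (proj₂ (simplePath t y (root t)))) u<y)

  no-three-separated : ∀ {a s t r} → Separated a s → Separated a t → Separated a r →
                       ¬ (graph (a ◂ s ◂ t ◂ r) ↣ G)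
  no-three-separated {a} {s} {t} {r} S T R f =
    [ not-between S f _ _
    , [ not-between T (f ∘ᵉ emb (swap₁₂ ◂ᵉ ↪-refl)) _ _
      , not-between R (f ∘ᵉ rotate₃) _ _ ] ]
    (middle L (ne λ ()) (ne λ ()) (ne λ ()))
    where
    ne : ∀ {v w} → v ≢ w → to f v ≢ to f w
    ne v≢w e = v≢w (injective f e)
    swap₁₂ : ∀ {t s} → a ◂ t ◂ s ↪ a ◂ s ◂ t
    swap₁₂ {t} {s} = ≃⇒↪ (◂-swap a t s)
    rotate₃ : graph (a ◂ r ◂ s ◂ t) ↣ graph (a ◂ s ◂ t ◂ r)
    rotate₃ = exchange ∘ᵉ emb (swap₁₂ ◂ᵉ ↪-refl)

  forbidden-absent : ∀ {H} → Forbidden H → ¬ (graph H ↣ G)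
  forbidden-absent t₀ f = at-most-four-arms L
    {xs = List.map (to f) (x₁ ∷ x₂ ∷ x₃ ∷ x₄ ∷ x₅ ∷ [])}
    (arm x₁ {inj₁ (inj₁ (inj₁ (inj₁ (inj₂ (inj₂ tt)))))} (refl , refl) (refl , refl) (λ ())
      ∷ arm x₂ {inj₁ (inj₁ (inj₁ (inj₂ (inj₂ tt))))} (refl , refl) (refl , refl) (λ ())
      ∷ arm x₃ {inj₁ (inj₁ (inj₂ (inj₂ tt)))} (refl , refl) (refl , refl) (λ ())
      ∷ arm x₄ {inj₁ (inj₂ (inj₂ tt))} (refl , refl) (refl , refl) (λ ())
      ∷ arm x₅ {inj₂ (inj₂ tt)} (refl , refl) (refl , refl) (λ ()) ∷ [])
    (map⁺ (injective f) (((λ ()) ∷ (λ ()) ∷ (λ ()) ∷ (λ ()) ∷ []) ∷ ((λ ()) ∷ (λ ()) ∷ (λ ()) ∷ [])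
      ∷ ((λ ()) ∷ (λ ()) ∷ []) ∷ ((λ ()) ∷ []) ∷ [] ∷ []))
    (s≤s (s≤s (s≤s (s≤s (s≤s z≤n)))))
    where
    x₁ x₂ x₃ x₄ x₅ : Vertex T₀
    x₁ = inj₁ (inj₁ (inj₁ (inj₁ (inj₂ (inj₁ tt)))))
    x₂ = inj₁ (inj₁ (inj₁ (inj₂ (inj₁ tt))))
    x₃ = inj₁ (inj₁ (inj₂ (inj₁ tt)))
    x₄ = inj₁ (inj₂ (inj₁ tt))
    x₅ = inj₂ (inj₁ tt)
    arm : ∀ x {d} → Edge T₀ x (root T₀) → Edge T₀ x d → d ≢ root T₀ → Arm L (to f (root T₀)) (to f x)
    arm x e e′ ne = hom f e , _ , hom f e′ , ne ∘ injective f
  forbidden-absent t₁ = no-three-separated near-4 near-4 near-4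
  forbidden-absent (t₂ (s≤s (s≤s _)) (s≤s (s≤s _)) (s≤s (s≤s _))) =
    no-three-separated (far • _) (far • _) (far • _)
  forbidden-absent (t₃ (s≤s (s≤s _)) (s≤s (s≤s _))) = no-three-separated near-4 (far • _) (far • _)
  forbidden-absent (t₄ (s≤s (s≤s _))) = no-three-separated near-4 near-4 (far • _)
  -- The leaf of `T₅` at `c` is absorbed into `• ◂ •`. A path of length `suc i` is `stem i`, so
  -- `zero` stands for length 1.
  forbidden-absent (t₅ (s≤s {n = i} _) (s≤s {n = j} _)) =
    no-three-separated near-3 (any-length i) (any-length j)
    where
    any-length : ∀ i → Separated (• ◂ •) (stem i (star 2))
    any-length zero    = near-3
    any-length (suc i) = far (• ◂ •) i

-- Construction of layouts

node : List RootedTree → RootedTree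
node []       = •
node (s ∷ ss) = node ss ◂ s

children : RootedTree → List RootedTree
children •       = []
children (t ◂ s) = s ∷ children t

node-children : ∀ t → node (children t) ≡ t
node-children •       = refl
node-children (t ◂ s) = cong (_◂ s) (node-children t)

node-↭ : ∀ {ss ts} → ss ↭ ts → node ss ≃ᵣ node ts
node-↭ refl          = ≃ᵣ-refl
node-↭ (prep s p)    = ◂-congˡ s (node-↭ p)
node-↭ (swap s t p)  = ≃ᵣ-trans (◂-congˡ s (◂-congˡ t (node-↭ p))) (◂-swap _ t s)
node-↭ (trans p q)   = ≃ᵣ-trans (node-↭ p) (node-↭ q)

node-mono : ∀ {ss ts} → Sublist _↪_ ss ts → node ss ↪ node ts
node-mono []       = ↪-refl
node-mono (t ∷ʳ p) = ↪-weaken t (node-mono p)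
node-mono (f ∷ p)  = node-mono p ◂ᵉ f

module _ {V W C : Set} {G : Graph V} {H : Graph W} where
  private
    module G = Graph G
    module H = Graph H

  pullback : (f : G ↣ H) → (∀ {u v} → to f u H.~ to f v → u G.~ v) → Layout H C → Layout G C
  pullback f reflect L = record
    { _<_                = λ u v → to f u L.< to f v
    ; class              = L.class ∘ to f
    ; isStrictTotalOrder = isStrictTotalOrderᶜ record
      { isEquivalence = ≡.isEquivalence
      ; trans         = L.<-trans
      ; compare       = compare
      }
    ; consistent         = λ p q e →
        let st , rs = L.consistent p q (hom f e) in reflect ∘ st , reflect ∘ rs
    }
    where
    module L = Layout L
    compare : Trichotomous _≡_ (λ u v → to f u L.< to f v)
    compare u v with L.compare (to f u) (to f v)
    ... | tri< p ¬q ¬r = tri< p (¬q ∘ cong (to f)) ¬r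
    ... | tri≈ ¬p q ¬r = tri≈ ¬p (injective f q) ¬r
    ... | tri> ¬p ¬q r = tri> ¬p (¬q ∘ cong (to f)) r

transport : ∀ {t s C} → t ≃ s → Layout (graph s) C → Layout (graph t) C
transport {t} i = pullback (fwd i) λ e →
  subst₂ (Edge t) (bwd-fwd i _) (bwd-fwd i _) (hom (bwd i) e)

⊎-<-compare : ∀ {A B : Set} {_<₁_ : Rel A 0ℓ} {_<₂_ : Rel B 0ℓ} →
              Trichotomous _≡_ _<₁_ → Trichotomous _≡_ _<₂_ → Trichotomous _≡_ (_<₁_ ⊎-< _<₂_)
⊎-<-compare c₁ c₂ (inj₁ x) (inj₁ y) with c₁ x y
... | tri< p ¬q ¬r = tri< (₁∼₁ p) (¬q ∘ inj₁-injective) (¬r ∘ drop-inj₁)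
... | tri≈ ¬p q ¬r = tri≈ (¬p ∘ drop-inj₁) (cong inj₁ q) (¬r ∘ drop-inj₁)
... | tri> ¬p ¬q r = tri> (¬p ∘ drop-inj₁) (¬q ∘ inj₁-injective) (₁∼₁ r)
⊎-<-compare c₁ c₂ (inj₁ x) (inj₂ y) = tri< ₁∼₂ (λ ()) (λ ())
⊎-<-compare c₁ c₂ (inj₂ x) (inj₁ y) = tri> (λ ()) (λ ()) ₁∼₂
⊎-<-compare c₁ c₂ (inj₂ x) (inj₂ y) with c₂ x y
... | tri< p ¬q ¬r = tri< (₂∼₂ p) (¬q ∘ inj₂-injective) (¬r ∘ drop-inj₂)
... | tri≈ ¬p q ¬r = tri≈ (¬p ∘ drop-inj₂) (cong inj₂ q) (¬r ∘ drop-inj₂)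
... | tri> ¬p ¬q r = tri> (¬p ∘ drop-inj₂) (¬q ∘ inj₂-injective) (₂∼₂ r)

-- Only the edge joining the two roots crosses from L to M, so only the vertices after the root
-- of t and those before the root of s are constrained.
module _ {t s : RootedTree} {C : Set} (L : Layout (graph t) C) (M : Layout (graph s) C) where
  private
    module L = Layout L
    module M = Layout M

  join : (∀ {x} → root t L.< x → L.class x ≢ L.class (root t) ×
                                 (L.class x ≡ M.class (root s) → Edge t (root t) x)) →
         (∀ {x} → x M.< root s → M.class x ≢ M.class (root s) ×
                                 (M.class x ≡ L.class (root t) → Edge s x (root s))) →
         Layout (graph (t ◂ s)) C
  join after before = record
    { _<_                = L._<_ ⊎-< M._<_
    ; class              = class
    ; isStrictTotalOrder = isStrictTotalOrderᶜ record
      { isEquivalence = ≡.isEquivalence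
      ; trans         = ⊎-<-transitive L.<-trans M.<-trans
      ; compare       = ⊎-<-compare L.compare M.compare
      }
    ; consistent         = λ {r} {x} {y} → consistent {r} {x} {y}
    }
    where
    class : Vertex (t ◂ s) → C
    class = [ L.class , M.class ]

    consistent : StronglyConsistent (graph (t ◂ s)) (L._<_ ⊎-< M._<_) class
    consistent (₁∼₁ p) (₁∼₁ q) e             = L.consistent p q e
    consistent (₂∼₂ p) (₂∼₂ q) e             = M.consistent p q e
    consistent (₁∼₁ p) ₁∼₂     (refl , refl) =
      (λ e → contradiction (≡.sym e) (proj₁ (after p))) , proj₂ (after p)
    consistent ₁∼₂     (₂∼₂ q) (refl , refl) =
      proj₂ (before q) ∘ ≡.sym , (λ e → contradiction e (proj₁ (before q)))

single : ∀ {C} → C → Layout (graph •) C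
single c = record
  { _<_                = λ _ _ → ⊥
  ; class              = λ _ → c
  ; isStrictTotalOrder = isStrictTotalOrderᶜ record
    { isEquivalence = ≡.isEquivalence
    ; trans         = λ ()
    ; compare       = λ _ _ → tri≈ (λ ()) refl (λ ())
    }
  ; consistent         = λ ()
  }

-- Layouts of paths and of single spine vertices

data IsPath : RootedTree → Set where
  •  : IsPath •
  •◂_ : ∀ {s} → IsPath s → IsPath (• ◂ s)

record Straight {C : Set} (c : C) (p : RootedTree) : Set₁ where
  field
    layout : Layout (graph p) C
  open Layout layout public
  field
    monochromatic : ∀ x → class x ≡ c
    root-first    : ∀ {x} → ¬ (x < root p)

straight : ∀ {C} (c : C) {p} → IsPath p → Straight c p
straight c •      = record { layout = single c ; monochromatic = λ _ → refl ; root-first = λ () }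
straight c (•◂ p) = record
  { layout        = join (single c) P.layout (λ ()) (⊥-elim ∘ P.root-first)
  ; monochromatic = λ { (inj₁ _) → refl ; (inj₂ x) → P.monochromatic x }
  ; root-first    = λ { (₁∼₁ ()) }
  }
  where
  module P = Straight (straight c p)

-- The spine of a layout is its class A, everything else is in class B.
A B : Fin 2
A = zero
B = suc zero

-- The spine starts at the root and runs down from it. Vertices off the spine may still precede the
-- root.
record Down (t : RootedTree) : Set₁ where
  field
    layout : Layout (graph t) (Fin 2)
  open Layout layout public
  field
    root-A     : class (root t) ≡ A
    root-first : ∀ {x} → x < root t → class x ≢ A

-- A single spine vertex, as root, with everything it carries off the spine.
record Block (t : RootedTree) : Set₁ where
  field
    layout : Layout (graph t) (Fin 2)
  open Layout layout public
  field
    root-A : class (root t) ≡ A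
    only-A : ∀ {x} → class x ≡ A → x ≡ root t

-- This is what `join` asks for when a path in class `B` is appended: the new edge at the root
-- passes over everything after the root, all of it in class `B`.
RightTight : ∀ {t} → Block t → Set
RightTight {t} β = ∀ {x} → root t < x → Edge t (root t) x
  where
  open Block β

reverseᵇ : ∀ {t} → Block t → Block t
reverseᵇ β = record { layout = reverse layout ; root-A = root-A ; only-A = only-A }
  where
  open Block β

LeftTight : ∀ {t} → Block t → Set
LeftTight = RightTight ∘ reverseᵇ

down-≃ : ∀ {t s} → t ≃ᵣ s → Down s → Down t
down-≃ i D = record
  { layout     = transport (iso i) layout
  ; root-A     = ≡.trans (cong class (fwd-root i)) root-A
  ; root-first = λ p → root-first (subst (_ <_) (fwd-root i) p)
  }
  where
  open Down D

•-block : Block •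
•-block = record { layout = single A ; root-A = refl ; only-A = λ _ → refl }

•-down : Down •
•-down = record { layout = single A ; root-A = refl ; root-first = λ () }

A≢B : ∀ {c : Fin 2} → c ≡ A → c ≢ B
A≢B refl ()

¬root<A : ∀ {t} (β : Block t) {x} → Block._<_ β (root t) x → Block.class β x ≢ A
¬root<A β p e with Block.only-A β e
... | refl = Block.<-irrefl β refl p

¬A<root : ∀ {t} (β : Block t) {x} → Block._<_ β x (root t) → Block.class β x ≢ A
¬A<root β = ¬root<A (reverseᵇ β)

module _ {t s : RootedTree} (L : Layout (graph t) (Fin 2)) (M : Layout (graph s) (Fin 2)) where
  private
    module L = Layout L
    module M = Layout M

  -- The new edge has both ends in class `A` and passes over vertices of class `B` only, so it
  -- imposes no adjacency.
  join-spines : L.class (root t) ≡ A → M.class (root s) ≡ A →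
                (∀ {x} → root t L.< x → L.class x ≢ A) → (∀ {x} → x M.< root s → M.class x ≢ A) →
                Layout (graph (t ◂ s)) (Fin 2)
  join-spines t-A s-A after before = join L M
    (λ p → (λ e → after p (≡.trans e t-A)) , λ e → contradiction (≡.trans e s-A) (after p))
    (λ p → (λ e → before p (≡.trans e s-A)) , λ e → contradiction (≡.trans e t-A) (before p))

_◂ᵈ_ : ∀ {t s} → Block t → Down s → Down (t ◂ s)
β ◂ᵈ D = record
  { layout     = join-spines β.layout D.layout β.root-A D.root-A (¬root<A β) D.root-first
  ; root-A     = β.root-A
  ; root-first = λ { (₁∼₁ p) → ¬A<root β p }
  }
  where
  module β = Block β
  module D = Down D

-- The two spines become one through the edge between the roots; the first must therefore end at its
-- root, whence the reversal.
opposite-spines : ∀ {t s} → Down t → Down s → Layout (graph (t ◂ s)) (Fin 2)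
opposite-spines {t} {s} D E =
  join-spines (reverse D.layout) E.layout D.root-A E.root-A D.root-first E.root-first
  where
  module D = Down D
  module E = Down E

module _ {t p : RootedTree} (β : Block t) (tight : RightTight β) (P : Straight B p) where
  private
    module β = Block β
    module P = Straight P

  attachʳ : Block (t ◂ p)
  attachʳ = record
    { layout = join β.layout P.layout
        (λ q → (λ e → ¬root<A β q (≡.trans e β.root-A)) , λ _ → tight q)
        (⊥-elim ∘ P.root-first)
    ; root-A = β.root-A
    ; only-A = λ { {inj₁ x} e → cong inj₁ (β.only-A e)
                 ; {inj₂ x} e → contradiction (P.monochromatic x) (A≢B e) }
    }

  -- The path comes after the root, so the left side is unchanged and can receive a second path
  -- after reversal, as in `path-block₂`.
  attachʳ-leftTight : LeftTight β → LeftTight attachʳ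
  attachʳ-leftTight lt (₁∼₁ q) = lt q

Leaves : List RootedTree → Set
Leaves = All (_≡ •)

-- All leaves go after the root. Being adjacent to it they keep the right side tight, and the left
-- side is empty.
leaves-block : ∀ {ls} → Leaves ls → ∃ λ (β : Block (node ls)) → LeftTight β × RightTight β
leaves-block []          = •-block , (λ ()) , λ ()
leaves-block (refl ∷ ls) with leaves-block ls
... | β , lt , rt = attachʳ β rt S , attachʳ-leftTight β rt S lt , λ { (₁∼₁ p) → rt p ; ₁∼₂ → refl , refl }
  where S = straight B •

path-block₁ : ∀ {p ls} → IsPath p → Leaves ls → ∃ λ (β : Block (node (p ∷ ls))) → LeftTight β
path-block₁ p ls with leaves-block ls
... | β , lt , rt = attachʳ β rt (straight B p) , attachʳ-leftTight β rt (straight B p) lt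

path-block₂ : ∀ {p q ls} → IsPath p → IsPath q → Leaves ls → Block (node (p ∷ q ∷ ls))
path-block₂ p q ls with path-block₁ q ls
... | β , lt = attachʳ (reverseᵇ β) lt (straight B p)

-- In the order (q reversed, the middle vertex) < the root < p.
slender-block : ∀ {p q} → IsPath p → IsPath q → Block (• ◂ (• ◂ q ◂ p))
slender-block {p} {q} isP isQ = record
  { layout = transport i K
  ; root-A = refl
  ; only-A = λ { {inj₁ _} _ → refl
               ; {inj₂ (inj₁ x)} e → contradiction (Q.monochromatic x) (A≢B e)
               ; {inj₂ (inj₂ x)} e → contradiction (P.monochromatic x) (A≢B e) }
  }
  where
  module P = Straight (straight B isP)
  module Q = Straight (straight B (•◂ isQ))

  J : Layout (graph (• ◂ q ◂ •)) (Fin 2)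
  J = join (reverse Q.layout) (single A) (⊥-elim ∘ Q.root-first) (λ ())

  -- The edge from the middle vertex to `p` passes over the spine vertex alone, whose class `A`
  -- differs from that of both ends.
  K : Layout (graph (• ◂ q ◂ • ◂ p)) (Fin 2)
  K = join J P.layout
    (λ { (₁∼₁ r) → ⊥-elim (Q.root-first r)
       ; ₁∼₂     → (λ ()) , λ e → contradiction (P.monochromatic _) (A≢B (≡.sym e)) })
    (⊥-elim ∘ P.root-first)

  i : • ◂ (• ◂ q ◂ p) ≃ • ◂ q ◂ • ◂ p
  i = ≃-trans (◂-comm _ _) (iso (◂-swap (• ◂ q) p •))

-- Finding a spine

Branching : RootedTree → Set
Branching s = ∃ λ i → stem i (star 2) ↪ s

-- The branches that can hang off a spine vertex as its only load. The alternative, `Strong`,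
-- describes the branches of `T₁` to `T₄`: a `star 3` next to `c`, or a `star 2` at distance at
-- least 2.
data Slender : RootedTree → Set where
  path : ∀ {p} → IsPath p → Slender p
  fork : ∀ {p q} → IsPath p → IsPath q → Slender (• ◂ q ◂ p)

data Strong (s : RootedTree) : Set where
  thick : star 3 ↪ s → Strong s
  deep  : ∀ i → stem (suc i) (star 2) ↪ s → Strong s

path-or-branching : ∀ s → IsPath s ⊎ Branching s
path-or-branching •           = inj₁ •
path-or-branching (• ◂ s)     =
  Sum.map •◂_ (λ (i , f) → suc i , (↪-refl ◂ᵉ f)) (path-or-branching s)
path-or-branching (t ◂ r ◂ s) = inj₂ (0 , ((•↪ t ◂ᵉ •↪ r) ◂ᵉ •↪ s))

slender-or-strong : ∀ s → Slender s ⊎ Strong s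
slender-or-strong •               = inj₁ (path •)
slender-or-strong (• ◂ s)         =
  Sum.map (path ∘ •◂_) (λ (i , f) → deep i (↪-refl ◂ᵉ f)) (path-or-branching s)
slender-or-strong (• ◂ r ◂ s)     with path-or-branching r | path-or-branching s
... | inj₁ q       | inj₁ p       = inj₁ (fork p q)
... | inj₁ _       | inj₂ (i , f) = inj₂ (deep i (↪-weaken r ↪-refl ◂ᵉ f))
... | inj₂ (i , f) | _            = inj₂ (deep i (↪-weaken s (↪-refl ◂ᵉ f)))
slender-or-strong (t ◂ q ◂ r ◂ s) = inj₂ (thick (((•↪ t ◂ᵉ •↪ q) ◂ᵉ •↪ r) ◂ᵉ •↪ s))

NonLeaf : RootedTree → Set
NonLeaf s = star 1 ↪ s

leaf-or-nonleaf : ∀ s → s ≡ • ⊎ NonLeaf s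
leaf-or-nonleaf •       = inj₁ refl
leaf-or-nonleaf (t ◂ s) = inj₂ (•↪ t ◂ᵉ •↪ s)

branching⇒nonleaf : ∀ {s} → Branching s → NonLeaf s
branching⇒nonleaf (zero  , f) = ↪-trans (↪-weaken • ↪-refl) f
branching⇒nonleaf (suc i , f) = ↪-trans (↪-refl ◂ᵉ •↪ _) f

slender⇒block : ∀ {s} → Slender s → Block (node (s ∷ []))
slender⇒block (path p)   = proj₁ (path-block₁ p [])
slender⇒block (fork p q) = slender-block p q

Good : RootedTree → Set₁
Good t = Layout (graph t) (Fin 2)

Bad : RootedTree → Set
Bad t = ∃ λ H → Forbidden H × graph H ↣ graph t

Outcome : RootedTree → Set₁
Outcome t = Good t ⊎ Bad t

outcome-≃ : ∀ {t s} → t ≃ s → Outcome s → Outcome t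
outcome-≃ i = Sum.map (transport i) λ (H , F , f) → H , F , bwd i ∘ᵉ f

-- The list `hs` gives the children of the forbidden tree from the last to the first, and so do the
-- calls below.
bad : ∀ {hs ss} → Forbidden (node hs) → Sublist _↪_ hs ss → Bad (node ss)
bad F p = _ , F , emb (node-mono p)

permuted : ∀ {ss ts} → ss ↭ ts → Outcome (node ts) → Outcome (node ss)
permuted = outcome-≃ ∘ iso ∘ node-↭

2≤ : ∀ i → 2 ≤ suc (suc i)
2≤ i = s≤s (s≤s z≤n)

5-nonleaves : ∀ {a b c d e ss} → NonLeaf a → NonLeaf b → NonLeaf c → NonLeaf d → NonLeaf e →
              Outcome (node (a ∷ b ∷ c ∷ d ∷ e ∷ ss))
5-nonleaves a b c d e = inj₂ (bad t₀ (a ∷ b ∷ c ∷ d ∷ e ∷ minimum _))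

-- With 0, 1, 2 or 3 deep branches the tree found is `T₁`, `T₄`, `T₃` or `T₂`; the remaining clauses
-- only reorder.
3-strong : ∀ {a b c ss} → Strong a → Strong b → Strong c → Outcome (node (a ∷ b ∷ c ∷ ss))
3-strong (thick f)  (thick g)  (thick h)  = inj₂ (bad t₁ (f ∷ g ∷ h ∷ minimum _))
3-strong (deep i f) (thick g)  (thick h)  = inj₂ (bad (t₄ (2≤ i)) (f ∷ g ∷ h ∷ minimum _))
3-strong (deep i f) (deep j g) (thick h)  =
  inj₂ (bad (t₃ (2≤ j) (2≤ i)) (f ∷ g ∷ h ∷ minimum _))
3-strong (deep i f) (deep j g) (deep k h) =
  inj₂ (bad (t₂ (2≤ k) (2≤ j) (2≤ i)) (f ∷ g ∷ h ∷ minimum _))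
3-strong (thick f)  (deep i g) (thick h)  =
  permuted (swap _ _ ↭-refl) (3-strong (deep i g) (thick f) (thick h))
3-strong (thick f)  (thick g)  (deep i h) = permuted third (3-strong (deep i h) (thick f) (thick g))
  where third = trans (prep _ (swap _ _ ↭-refl)) (swap _ _ ↭-refl)
3-strong (deep i f) (thick g)  (deep j h) =
  permuted (prep _ (swap _ _ ↭-refl)) (3-strong (deep i f) (deep j h) (thick g))
3-strong (thick f)  (deep i g) (deep j h) = permuted first (3-strong (deep i g) (deep j h) (thick f))
  where first = trans (swap _ _ ↭-refl) (prep _ (swap _ _ ↭-refl))

-- If one branching vertex is adjacent to the centre, it serves as `w` in `T₅` and `x` as the leaf,
-- the other two paths having any length. Otherwise all three paths have length at least 2, which
-- gives `T₂`.
3-branching : ∀ {x a b c ss} → Branching a → Branching b → Branching c →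
              Outcome (node (x ∷ a ∷ b ∷ c ∷ ss))
3-branching {x} {a} {b} {c} {ss} = cases
  where
  near : ∀ {a b c} → star 2 ↪ a → Branching b → Branching c → Outcome (node (x ∷ a ∷ b ∷ c ∷ ss))
  near {a} {b} {c} f (i , g) (j , h) = permuted
    (trans (shift b (x ∷ a ∷ []) (c ∷ ss))
      (prep b (trans (shift c (x ∷ a ∷ []) ss) (prep c (swap x a ↭-refl)))))
    (inj₂ (bad (t₅ {i = suc j} {j = suc i} (s≤s z≤n) (s≤s z≤n)) (g ∷ h ∷ f ∷ •↪ x ∷ minimum _)))

  cases : Branching a → Branching b → Branching c → Outcome (node (x ∷ a ∷ b ∷ c ∷ ss))
  cases (zero  , f) g           h           = near f g h
  cases f           (zero  , g) h           = permuted (prep x (swap a b ↭-refl)) (near g f h)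
  cases f           g           (zero  , h) = permuted (prep x (shift c (a ∷ b ∷ []) ss)) (near h f g)
  cases (suc i , f) (suc j , g) (suc k , h) =
    inj₂ (bad (t₂ (2≤ k) (2≤ j) (2≤ i)) (x ∷ʳ f ∷ g ∷ h ∷ minimum _))

-- The spine comes up from `a`, turns at the present root and goes down to `b`; this settles the
-- whole tree.
through : ∀ {a b ss} → Down a → Down b → Block (node ss) → Outcome (node (a ∷ b ∷ ss))
through {a} {b} {ss} Da Db β =
  inj₁ (transport (◂-comm (node ss ◂ b) a) (opposite-spines Da (β ◂ᵈ Db)))

record Long (s : RootedTree) : Set where
  field
    isPath  : IsPath s
    nonleaf : NonLeaf s

open Long

-- Longer paths are kept apart from leaves: a block holds at most two of them but any number of
-- leaves, and only they count towards `T₀`.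
record Sorted (ss : List RootedTree) : Set₁ where
  field
    {bs qs ls} : List RootedTree
    perm       : ss ↭ bs ++ qs ++ ls
    bs-down    : All Down bs
    bs-branch  : All Branching bs
    qs-down    : All Down qs
    qs-long    : All Long qs
    ls-leaves  : Leaves ls

sort : ∀ {ss} → All Down ss → Sorted ss
sort [] = record { perm = ↭-refl ; bs-down = [] ; bs-branch = [] ; qs-down = [] ; qs-long = []
                 ; ls-leaves = [] }
sort {s ∷ ss} (D ∷ Ds) with path-or-branching s | leaf-or-nonleaf s
... | inj₂ b | _         = record
  { perm = prep s perm ; bs-down = D ∷ bs-down ; bs-branch = b ∷ bs-branch
  ; qs-down = qs-down ; qs-long = qs-long ; ls-leaves = ls-leaves }
  where
  open Sorted (sort Ds)
... | inj₁ p | inj₂ nonleaf = record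
  { perm = trans (prep s perm) (↭-sym (shift s bs (qs ++ ls)))
  ; bs-down = bs-down ; bs-branch = bs-branch
  ; qs-down = D ∷ qs-down ; qs-long = record { isPath = p ; nonleaf = nonleaf } ∷ qs-long
  ; ls-leaves = ls-leaves }
  where
  open Sorted (sort Ds)
... | inj₁ p | inj₁ leaf = record
  { perm = trans (prep s perm) (↭-sym (trans (prep-all bs (shift s qs ls)) (shift s bs (qs ++ ls))))
  ; bs-down = bs-down ; bs-branch = bs-branch ; qs-down = qs-down ; qs-long = qs-long
  ; ls-leaves = leaf ∷ ls-leaves }
  where
  open Sorted (sort Ds)
  prep-all : ∀ rs {ts us} → ts ↭ us → rs ++ ts ↭ rs ++ us
  prep-all []       p = p
  prep-all (r ∷ rs) p = prep r (prep-all rs p)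

-- The spine continues into `d`, and up to two long paths fit into the block. With four there is a
-- `T₀`. With three, `u` is a fifth nonleaf, or it is a leaf and the spine turns from `d` into one
-- of the paths.
one-spine-child : ∀ {d qs ls} u → Down d → NonLeaf d → All Down qs → All Long qs → Leaves ls →
                  Down (node (d ∷ qs ++ ls)) ⊎ Outcome (node (u ∷ d ∷ qs ++ ls))
one-spine-child u D n _ []                   ls = inj₁ (proj₁ (leaves-block ls) ◂ᵈ D)
one-spine-child u D n _ (q ∷ [])             ls = inj₁ (proj₁ (path-block₁ (isPath q) ls) ◂ᵈ D)
one-spine-child u D n _ (q ∷ r ∷ [])         ls = inj₁ (path-block₂ (isPath q) (isPath r) ls ◂ᵈ D)
one-spine-child u D n _ (q ∷ r ∷ s ∷ t ∷ _)  ls =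
  inj₂ (inj₂ (bad t₀ (u ∷ʳ n ∷ nonleaf q ∷ nonleaf r ∷ nonleaf s ∷ nonleaf t ∷ minimum _)))
one-spine-child {d} {q ∷ r ∷ s ∷ []} {ls} u D n (Dq ∷ _) (lq ∷ lr ∷ lsg ∷ []) lvs with leaf-or-nonleaf u
... | inj₁ refl = inj₂ (permuted
  (↭-sym (shift • (d ∷ q ∷ r ∷ s ∷ []) ls))
  (through D Dq (path-block₂ (isPath lr) (isPath lsg) (refl ∷ lvs))))
... | inj₂ nu = inj₂ (5-nonleaves nu n (nonleaf lq) (nonleaf lr) (nonleaf lsg))

-- If `u` is a path, the spine turns from `a` to `b` with `u` in the block, unless long paths give a
-- `T₀`. If `u` branches, a further child gives `3-branching`; without one, any slender branch among
-- `a`, `b`, `u` can leave the spine, and otherwise all three are strong.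
two-spine-children : ∀ {a b qs ls} u → Down a → Down b → Branching a → Branching b →
                     All Long qs → Leaves ls →
                     Down (node (a ∷ b ∷ qs ++ ls)) ⊎ Outcome (node (u ∷ a ∷ b ∷ qs ++ ls))
two-spine-children {a} {b} {qs} {ls} u Da Db ba bb lqs lls with path-or-branching u
... | inj₁ p = inj₂ (path-parent lqs)
  where
  to-front : ∀ {ts} → u ∷ a ∷ b ∷ ts ↭ a ∷ b ∷ u ∷ ts
  to-front {ts} = ↭-sym (shift u (a ∷ b ∷ []) ts)

  path-parent : ∀ {qs} → All Long qs → Outcome (node (u ∷ a ∷ b ∷ qs ++ ls))
  path-parent []       = permuted to-front (through Da Db (proj₁ (path-block₁ p lls)))
  path-parent (q ∷ []) = permuted to-front (through Da Db (path-block₂ p (isPath q) lls))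
  path-parent (_∷_ {x = q} lq (_∷_ {x = r} lr lqs)) with leaf-or-nonleaf u | lqs
  ... | inj₂ nu   | _       =
    5-nonleaves nu (branching⇒nonleaf ba) (branching⇒nonleaf bb) (nonleaf lq) (nonleaf lr)
  ... | inj₁ refl | ls′ ∷ _ = inj₂ (bad t₀ (• ∷ʳ branching⇒nonleaf ba ∷ branching⇒nonleaf bb ∷
    nonleaf lq ∷ nonleaf lr ∷ nonleaf ls′ ∷ minimum _))
  ... | inj₁ refl | []      = permuted (↭-sym (shift • (a ∷ b ∷ q ∷ r ∷ []) ls))
    (through Da Db (path-block₂ (isPath lq) (isPath lr) (refl ∷ lls)))
... | inj₂ bu = branching-parent (qs ++ ls)
  where
  branching-parent : ∀ rs → Down (node (a ∷ b ∷ rs)) ⊎ Outcome (node (u ∷ a ∷ b ∷ rs))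
  branching-parent (x ∷ rs) =
    inj₂ (permuted (shift x (u ∷ a ∷ b ∷ []) rs) (3-branching bu ba bb))
  branching-parent [] with slender-or-strong a | slender-or-strong b | slender-or-strong u
  ... | inj₁ sa | _       | _       = inj₁ (down-≃ (node-↭ (swap a b ↭-refl)) (slender⇒block sa ◂ᵈ Db))
  ... | inj₂ _  | inj₁ sb | _       = inj₁ (slender⇒block sb ◂ᵈ Da)
  ... | inj₂ _  | inj₂ _  | inj₁ su = inj₂ (permuted (↭-sym (shift u (a ∷ b ∷ []) []))
    (through Da Db (slender⇒block su)))
  ... | inj₂ sa | inj₂ sb | inj₂ su = inj₂ (3-strong su sa sb)

decide-sorted : ∀ {bs qs ls} u → All Down bs → All Branching bs → All Down qs → All Long qs → Leaves ls →
                Down (node (bs ++ qs ++ ls)) ⊎ Outcome (node (u ∷ bs ++ qs ++ ls))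
decide-sorted u [] _ [] [] []                   = inj₁ •-down
-- One leaf becomes the last vertex of the spine.
decide-sorted u [] _ [] [] (refl ∷ ls)          = inj₁ (proj₁ (leaves-block ls) ◂ᵈ •-down)
decide-sorted u [] _ (D ∷ Ds) (q ∷ qs) ls       = one-spine-child u D (nonleaf q) Ds qs ls
decide-sorted u (D ∷ []) (b ∷ []) Ds qs ls      = one-spine-child u D (branching⇒nonleaf b) Ds qs ls
decide-sorted u (D ∷ E ∷ []) (b ∷ c ∷ []) _ qs ls = two-spine-children u D E b c qs ls
decide-sorted u (_ ∷ _ ∷ _ ∷ _) (a ∷ b ∷ c ∷ _) _ _ _ = inj₂ (3-branching a b c)

decide : ∀ {ss} u → All Down ss → Down (node ss) ⊎ Outcome (node (u ∷ ss))
decide u Ds = Sum.map (down-≃ (node-↭ perm)) (permuted (prep u perm))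
  (decide-sorted u bs-down bs-branch qs-down qs-long ls-leaves)
  where
  open Sorted (sort Ds)

-- While the children of a vertex are treated in turn, `rs` holds those already treated and the part
-- above the vertex, so `graft t rs` is the rest of the tree as seen from the current child.
graft : RootedTree → List RootedTree → RootedTree
graft t []       = t
graft t (r ∷ rs) = graft (t ◂ r) rs

graft-cong : ∀ {t t′} rs → t ≃ᵣ t′ → graft t rs ≃ᵣ graft t′ rs
graft-cong []       i = i
graft-cong (r ∷ rs) i = graft-cong rs (◂-congˡ r i)

graft-swap : ∀ t d rs → graft (t ◂ d) rs ≃ᵣ graft t rs ◂ d
graft-swap t d []       = ≃ᵣ-refl
graft-swap t d (r ∷ rs) = ≃ᵣ-trans (graft-cong rs (◂-swap t d r)) (graft-swap (t ◂ r) d rs)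

-- Either a spine can run down s from its root, or s ◂ u is settled: u is the rest of the tree.
descend     : ∀ s u → Down s ⊎ Outcome (s ◂ u)
descend-all : ∀ t rs → All Down (children t) ⊎ Outcome (graft t rs)

descend s u with descend-all s (u ∷ [])
... | inj₂ o  = inj₂ o
... | inj₁ Ds = subst (λ t → Down t ⊎ Outcome (t ◂ u)) (node-children s) (decide u Ds)

descend-all •       rs = inj₁ []
descend-all (t ◂ d) rs with descend d (graft t rs)
... | inj₂ o = inj₂ (outcome-≃ (≃-trans (iso (graft-swap t d rs)) (◂-comm _ d)) o)
... | inj₁ D = Sum.map₁ (D ∷_) (descend-all t (d ∷ rs))

-- Following last children down from `s` ends at a leaf, which becomes the root; the tree is then a
-- leaf with one branch `r`.
reroot : ∀ t s → ∃ λ r → t ◂ s ≃ • ◂ r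
reroot t •        = t , ◂-comm t •
reroot t (s ◂ s′) = let r , i = reroot (s ◂ t) s′ in r , ≃-trans (◂-rotate t s s′) i

outcome : ∀ t → Outcome t
outcome •       = inj₁ (single A)
outcome (t ◂ s) with reroot t s
... | r , i with descend r •
...   | inj₁ D = outcome-≃ i (inj₁ (Down.layout (•-block ◂ᵈ D)))
...   | inj₂ o = outcome-≃ (≃-trans i (◂-comm • r)) o

-- Rooted at a leaf, a tree is a path unless some vertex below the root has two children; its parent
-- is then its third neighbour.
path-or-claw : ∀ t → Layout (graph t) (Fin 1) ⊎ ∃ (Claw (graph t))
path-or-claw •       = inj₁ (single zero)
path-or-claw (t ◂ s) with reroot t s
... | r , i with path-or-branching r
...   | inj₁ p       = inj₁ (transport i (Straight.layout (straight zero (•◂ p))))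
...   | inj₂ (j , f) = inj₂ (_ , mapᶜ (bwd i ∘ᵉ emb (↪-refl ◂ᵉ f)) (centre-claw • j))

-- Trees on Fin n

unique-length-≤ : ∀ {A : Set} {xs ys : List A} → Unique xs → All (_∈ ys) xs → length xs ≤ length ys
unique-length-≤ {xs = xs} {ys} uniq ps = injective⇒≤ {f = f} λ {i} {j} e → lookup-injective uniq
  (≡.trans (lookup-index (mem i)) (≡.trans (cong (lookup ys) e) (≡.sym (lookup-index (mem j)))))
  where
  mem : ∀ i → lookup xs i ∈ ys
  mem i = All.lookup ps (∈-lookup i)
  f : Fin (length xs) → Fin (length ys)
  f = index ∘ mem

thinness⇒layout : ∀ {V k} {G : Graph V} → ProperlyThin G k → Layout G (Fin k)
thinness⇒layout (_<_ , class , sto , _ , sc) = record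
  { _<_ = _<_ ; class = class ; isStrictTotalOrder = sto ; consistent = sc }

layout⇒thinness : ∀ {V k} {G : Graph V} (L : Layout G (Fin k)) →
                  Surjective _≡_ _≡_ (Layout.class L) → ProperlyThin G k
layout⇒thinness L onto = _<_ , class , isStrictTotalOrder , onto , consistent
  where
  open Layout L

∈-≡ : ∀ {n} {S : Subset n} {p q : ∃ (Subset._∈ S)} → proj₁ p ≡ proj₁ q → p ≡ q
∈-≡ {p = _ , p} {_ , q} refl = cong (_ ,_) ([]=-irrelevant p q)

module _ {n : ℕ} (T : Graph (Fin n)) where
  open Graph T

  degree⇒claw : ∀ {v} → 3 ≤ degree T v → Claw T v
  degree⇒claw {v} d with filter (v ~?_) (allFin n) | all-filter (v ~?_) (allFin n)
                       | filter⁺ (v ~?_) (allFin⁺ n)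
  degree⇒claw (s≤s (s≤s (s≤s _))) | _ ∷ _ ∷ _ ∷ _ | p ∷ q ∷ r ∷ _
    | (x≢y ∷ x≢z ∷ _) ∷ (y≢z ∷ _) ∷ _ = record
    { v~x = p ; v~y = q ; v~z = r ; x≢y = x≢y ; x≢z = x≢z ; y≢z = y≢z }

  claw⇒degree : ∀ {v} → Claw T v → 3 ≤ degree T v
  claw⇒degree {v} k = unique-length-≤ ((x≢y ∷ x≢z ∷ []) ∷ (y≢z ∷ []) ∷ [] ∷ [])
    (neighbour v~x ∷ neighbour v~y ∷ neighbour v~z ∷ [])
    where
    open Claw k
    neighbour : ∀ {u} → v ~ u → u ∈ filter (v ~?_) (allFin n)
    neighbour {u} = ∈-filter⁺ (v ~?_) (∈-allFin u)

  containsInduced⇒embedding : ∀ {H} → ContainsInduced T (graph H) → graph H ↣ T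
  containsInduced⇒embedding (S , i) = record
    { to        = proj₁ ∘ Inverse.to bijection
    ; injective = λ e → ≡.trans (≡.sym (strictlyInverseʳ _)) (≡.trans (cong from (∈-≡ e)) (strictlyInverseʳ _))
    ; hom       = λ {u} {v} → Equivalence.to (edges u v)
    }
    where
    open _≅_ i
    open Inverse bijection using (from; strictlyInverseʳ)

  embedding⇒containsInduced : ¬ Cycle T → ∀ {H} → graph H ↣ T → ContainsInduced T (graph H)
  embedding⇒containsInduced acyclic {H} f = S , record
    { bijection = mk↔ₛ′ (λ u → to f u , in-image u) (proj₁ ∘ preimage)
        (λ p → ∈-≡ (proj₂ (preimage p)))
        (λ u → injective f (proj₂ (preimage (to f u , in-image u))))
    ; edges = λ u v → mk⇔ (hom f) (reflects acyclic f)
    }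
    where
    hit? : ∀ v → Dec (∃ λ u → to f u ≡ v)
    hit? v = any? H λ u → to f u Fin.≟ v
    S : Subset n
    S = tabulate (does ∘ hit?)
    in-image : ∀ u → to f u Subset.∈ S
    in-image u = lookup⇒[]= (to f u) S
      (≡.trans (lookup∘tabulate (does ∘ hit?) (to f u)) (dec-true (hit? (to f u)) (u , refl)))
    preimage : (p : ∃ (Subset._∈ S)) → ∃ λ u → to f u ≡ proj₁ p
    preimage (v , p) with hit? v | ≡.trans (≡.sym (lookup∘tabulate (does ∘ hit?) v)) ([]=⇒lookup p)
    ... | yes h | _ = h

  module _ (isTree : IsTree T) where
    open IsTree isTree
    open Acyclic T acyclic

    -- The rooted tree covers all vertices, and its embedding reflects edges because `T` is acyclic;
    -- so choosing preimages gives an isomorphism.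
    spanning : ∃ λ t → graph t ↣ T × ∃ λ (g : T ↣ graph t) → ∀ {u v} → Edge t (to g u) (to g v) → u ~ v
    spanning with cover T isTree (allFin n)
    ... | t , f , c = t , f , record
      { to        = g
      ; injective = λ e → ≡.trans (≡.sym (f-g _)) (≡.trans (cong (to f) e) (f-g _))
      ; hom       = λ e → reflects acyclic f (subst₂ _~_ (≡.sym (f-g _)) (≡.sym (f-g _)) e)
      } , λ e → subst₂ _~_ (f-g _) (f-g _) (hom f e)
      where
      g : Fin n → Vertex t
      g v = proj₁ (c (∈-allFin v))
      f-g : ∀ v → to f (g v) ≡ v
      f-g v = proj₂ (c (∈-allFin v))

    thin-1-or-claw : ProperlyThin T 1 ⊎ ∃ (Claw T)
    thin-1-or-claw with spanning
    ... | t , f , g , reflect with path-or-claw t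
    ...   | inj₁ L       = inj₁ (layout⇒thinness (pullback g reflect L)
      λ { zero → nonempty , λ _ → all-zero _ })
      where
      all-zero : ∀ (i : Fin 1) → i ≡ zero
      all-zero zero = refl
    ...   | inj₂ (_ , k) = inj₂ (_ , mapᶜ f k)

    -- By `claw-bichromatic` some neighbour of `v` lies outside the class of `v`, so both classes
    -- occur.
    claw⇒surjective : ∀ {v} → Claw T v → (L : Layout T (Fin 2)) → Surjective _≡_ _≡_ (Layout.class L)
    claw⇒surjective {v} k L i with Layout.class L v Fin.≟ i
    ... | yes e = v , λ { refl → e }
    ... | no ne = let w , e = other in w , λ { refl → other-class (ne ∘ ≡.sym) e }
      where
      open Claw k
      open Layout L
      other : ∃ λ w → class w ≢ class v
      other with class x Fin.≟ class v | class y Fin.≟ class v | class z Fin.≟ class v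
      ... | no p  | _     | _     = x , p
      ... | _     | no p  | _     = y , p
      ... | _     | _     | no p  = z , p
      ... | yes p | yes q | yes r = ⊥-elim (claw-bichromatic L k (p , q , r))

    claw⇒2≤ : ∀ {v} → Claw T v → ∀ j → ProperlyThin T j → 2 ≤ j
    claw⇒2≤ k zero          P with Layout.class (thinness⇒layout {G = T} P) nonempty
    ... | ()
    claw⇒2≤ k (suc zero)    P =
      ⊥-elim (claw-bichromatic (thinness⇒layout P) k (all-equal _ _ , all-equal _ _ , all-equal _ _))
      where
      all-equal : ∀ (i j : Fin 1) → i ≡ j
      all-equal zero zero = refl
    claw⇒2≤ k (suc (suc j)) P = 2≤ j

    good-layout : (∀ {H} → Forbidden H → ¬ ContainsInduced T (graph H)) → Layout T (Fin 2)
    good-layout absent with spanning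
    ... | t , f , g , reflect with outcome t
    ...   | inj₁ L           = pullback g reflect L
    ...   | inj₂ (H , F , h) = ⊥-elim (absent F (embedding⇒containsInduced acyclic (f ∘ᵉ h)))

theorem4 : ∀ {n : ℕ} (T : Graph (Fin n)) → IsTree T →
    HasProperThinness T 2 ⇔
    ((∃ λ v → 3 ≤ degree T v) ×
    (∀ {H} → Forbidden H → ¬ ContainsInduced T (graph H)))
theorem4 T isTree = mk⇔
  (λ (P , least) →
      [ (λ P₁ → case least 1 P₁ of λ { (s≤s ()) }) , (λ (v , k) → v , claw⇒degree T k) ]
        (thin-1-or-claw T isTree)
    , λ F c → Refutation.forbidden-absent T (IsTree.acyclic isTree) (thinness⇒layout P) F
                (containsInduced⇒embedding T c))
  λ ((v , d) , absent) →
    let k = degree⇒claw T d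
        L = good-layout T isTree absent
    in layout⇒thinness L (claw⇒surjective T isTree k L) , claw⇒2≤ T isTree k
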